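{- Let $\kappa$ be an uncountable regular cardinal and let $\mathcal{I}$ be a $\kappa$-complete proper ideal on $\kappa$ containing every bounded subset of $\kappa$. Let $\nu\in\{2,\kappa\}$. Then the $\mathcal{I}$-Borel hierarchy on ${}^{\kappa}\nu$ does not collapse: for every ordinal $\alpha$ with $1\le\alpha<\kappa^+$ we have $\boldsymbol{\Sigma}^0_\alpha({}^{\kappa}\nu,\tau_{\mathcal{I}})\neq \mathcal{I}\text{ - }\mathbf{Bor}({}^{\kappa}\nu)$. Hence the hierarchy has length $\kappa^+$, both for ${}^{\kappa}2$ and for ${}^{\kappa}\kappa$.
   Context: Work in ZFC. For $\nu\in\{2,\kappa\}$, ${}^{\kappa}\nu$ is the set of all functions $\kappa\to\nu$. Let $\mathrm{Fn}_{\mathcal{I}}({}^{\kappa}\nu)$ be the set of functions $f\colon D\to\nu$ with $D\in\mathcal{I}$, and for such $f$ let $\mathbf{N}_f=\{x\in{}^{\kappa}\nu: f\subseteq x\}$. The $\mathcal{I}$-topology $\tau_{\mathcal{I}}$ on ${}^{\kappa}\nu$ is the topology generated by the sets $\mathbf{N}_f$, $f\in\mathrm{Fn}_{\mathcal{I}}({}^{\kappa}\nu)$. $\mathcal{I}\text{ - }\mathbf{Bor}({}^{\kappa}\nu)$ is the smallest family of subsets of ${}^{\kappa}\nu$ containing $\tau_{\mathcal{I}}$ and closed under complements and unions of at most $\kappa$ sets. The hierarchy is defined by recursion on $\alpha\ge1$: $\boldsymbol{\Sigma}^0_1$ = the $\tau_{\mathcal{I}}$-open sets, $\boldsymbol{\Pi}^0_1$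 = the $\tau_{\mathcal{I}}$-closed sets; for $\alpha>1$, $\boldsymbol{\Sigma}^0_\alpha$ consists of all unions $\bigcup_{\gamma<\kappa}A_\gamma$ with each $A_\gamma\in\bigcup_{1\le\beta<\alpha}\boldsymbol{\Pi}^0_\beta$, and $\boldsymbol{\Pi}^0_\alpha$ consists of the complements of sets in $\boldsymbol{\Sigma}^0_\alpha$. The hierarchy is said to collapse if $\min\{\alpha:\boldsymbol{\Sigma}^0_\alpha({}^{\kappa}\nu,\tau_{\mathcal{I}})=\mathcal{I}\text{ - }\mathbf{Bor}({}^{\kappa}\nu)\}<\kappa^+$. -}

module Defs where

open import Agda.Primitive using (Setω)
open import Level using (0ℓ; suc)
open import Axiom.ExcludedMiddle using (ExcludedMiddle)
open import Axiom.Extensionality.Propositional using (Extensionality)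
open import Data.Bool using (Bool)
open import Data.Maybe using (Maybe; just; Is-just)
open import Data.Nat using (ℕ)
open import Data.Product using (∃; _×_)
open import Function.Bundles using (_↣_; Injection)
open import Induction.WellFounded using (WellFounded)
open import Relation.Binary.Core using (Rel)
open import Relation.Binary.PropositionalEquality using (_≡_)
open import Relation.Binary.Structures using (IsStrictTotalOrder)
open import Relation.Nullary using (¬_)
open import Relation.Unary using (Pred; U; ∅; ∁; _∈_; _∉_; _⊆_; _≐_; _∩_; _∪_; ⋃)

-- The set-theoretic background.  Types in Set play the role of sets,
-- subsets are predicates compared by _≐_.  Excluded middle is assumed for
-- arbitrary types, not only for those with at most one element, so it turns
-- every ¬ ¬ A into an element of A: the axiom of choice is a consequence.

record Classical : Setω where
  field
    excludedMiddle : ∀ {ℓ} → ExcludedMiddle ℓ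
    extensionality : ∀ {a b} → Extensionality a b

Family : Set → Set₂
Family A = Pred (Pred A 0ℓ) (suc 0ℓ)

-- An ordinal is given as an element α of a well-ordered set W and stands for
-- the order type of { β ∈ W ∣ β < α }.  Every ordinal arises in this way
-- (α is the last element of α + 1).

record WellOrder : Set₁ where
  infix 4 _<_
  field
    Carrier            : Set
    _<_                : Rel Carrier 0ℓ
    isStrictTotalOrder : IsStrictTotalOrder _≡_ _<_
    wellFounded        : WellFounded _<_

open WellOrder public using (Carrier)

Positive : (W : WellOrder) → Pred (Carrier W) 0ℓ
Positive W α = let open WellOrder W using (_<_) in ∃ λ β → β < α

IsOne : (W : WellOrder) → Pred (Carrier W) 0ℓ
IsOne W α = let open WellOrder W using (_<_) in
  Positive W α × (∀ {β} → β < α → ¬ Positive W β)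

-- A function on an initial segment is represented by a function on the whole
-- order whose values outside the segment are ignored.

record IsUncountableRegular (κ : WellOrder) : Set where
  open WellOrder κ using (_<_)
  field
    cardinal    : ∀ α → ¬ (∃ λ (f : Carrier κ ↣ Carrier κ) →
                           ∀ γ → Injection.to f γ < α)
    uncountable : ¬ (Carrier κ ↣ ℕ)
    regular     : ∀ α (f : Carrier κ → Carrier κ) →
                  ∃ λ β → ∀ {γ} → γ < α → f γ < β

-- α < κ⁺, that is, |α| ≤ κ.

BelowSuccessor : (κ W : WellOrder) → Pred (Carrier W) 0ℓ
BelowSuccessor κ W α = let open WellOrder W using (_<_) in
  ∃ λ (f : Carrier W → Carrier κ) →
    ∀ {β γ} → β < α → γ < α → f β ≡ f γ → β ≡ γ

-- α = κ⁺, the least ordinal of cardinality greater than κ.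

IsSuccessor : (κ W : WellOrder) → Pred (Carrier W) 0ℓ
IsSuccessor κ W α = let open WellOrder W using (_<_) in
  ¬ BelowSuccessor κ W α × (∀ {β} → β < α → BelowSuccessor κ W β)

record IsCompleteProperIdeal (κ : WellOrder) (𝓘 : Family (Carrier κ)) : Set₁ where
  open WellOrder κ using (_<_)
  field
    empty    : ∅ ∈ 𝓘
    downward : ∀ {A B} → A ⊆ B → B ∈ 𝓘 → A ∈ 𝓘
    union    : ∀ {A B} → A ∈ 𝓘 → B ∈ 𝓘 → A ∪ B ∈ 𝓘
    proper   : U ∉ 𝓘
    complete : ∀ α (A : Carrier κ → Pred (Carrier κ) 0ℓ) →
               (∀ {γ} → γ < α → A γ ∈ 𝓘) →
               (λ δ → ∃ λ γ → γ < α × δ ∈ A γ) ∈ 𝓘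

ContainsBounded : (κ : WellOrder) → Pred (Family (Carrier κ)) (suc 0ℓ)
ContainsBounded κ 𝓘 = let open WellOrder κ using (_<_) in
  ∀ (A : Pred (Carrier κ) 0ℓ) → (∃ λ β → ∀ {γ} → γ ∈ A → γ < β) → A ∈ 𝓘

-- The topology generated by ℬ.  With excluded middle the predicates on X are
-- represented by X → Bool, so index types in Set reach every family of
-- subsets of X.

data Generated {X : Set} (ℬ : Family X) : Family X where
  basic : ∀ {A} → A ∈ ℬ → A ∈ Generated ℬ
  whole : U ∈ Generated ℬ
  inter : ∀ {A B} → A ∈ Generated ℬ → B ∈ Generated ℬ → A ∩ B ∈ Generated ℬ
  union : ∀ {J : Set} (A : J → Pred X 0ℓ) →
          (∀ j → A j ∈ Generated ℬ) → ⋃ J A ∈ Generated ℬ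
  resp  : ∀ {A B} → A ≐ B → A ∈ Generated ℬ → B ∈ Generated ℬ

data Base : Set where
  two kappa : Base

module Hierarchy (κ : WellOrder) (𝓘 : Family (Carrier κ)) (ν : Base) where

  K : Set
  K = Carrier κ

  ⟦_⟧ : Base → Set
  ⟦ two ⟧   = Bool
  ⟦ kappa ⟧ = K

  Space : Set
  Space = K → ⟦ ν ⟧

  PartialFunction : Set
  PartialFunction = K → Maybe ⟦ ν ⟧

  dom : PartialFunction → Pred K 0ℓ
  dom f γ = Is-just (f γ)

  𝐍 : PartialFunction → Pred Space 0ℓ
  𝐍 f x = ∀ γ i → f γ ≡ just i → x γ ≡ i

  BasicOpen : Family Space
  BasicOpen A = ∃ λ f → dom f ∈ 𝓘 × A ≐ 𝐍 f

  Open : Family Space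
  Open = Generated BasicOpen

  data Bor : Family Space where
    open′      : ∀ {A} → A ∈ Open → A ∈ Bor
    complement : ∀ {A} → A ∈ Bor → ∁ A ∈ Bor
    union      : ∀ {J : Set} → J ↣ K → (A : J → Pred Space 0ℓ) →
                 (∀ j → A j ∈ Bor) → ⋃ J A ∈ Bor
    resp       : ∀ {A B} → A ≐ B → A ∈ Bor → B ∈ Bor

  -- Recursion on α ≥ 1; both classes are empty at the least element of W.
  -- In `step` the ordinal α is automatically greater than 1, as K is nonempty.

  module _ (W : WellOrder) where

    open WellOrder W using (_<_)

    data Σ⁰ : Carrier W → Family Space
    data Π⁰ : Carrier W → Family Space

    data Σ⁰ where
      one   : ∀ {α A} → IsOne W α → A ∈ Open → A ∈ Σ⁰ α
      step  : ∀ {α B} (A : K → Pred Space 0ℓ) →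
              (∀ γ → ∃ λ β → Positive W β × β < α × A γ ∈ Π⁰ β) →
              B ≐ ⋃ K A → B ∈ Σ⁰ α

    data Π⁰ where
      compl : ∀ {α A B} → A ∈ Σ⁰ α → B ≐ ∁ A → B ∈ Π⁰ α

    -- α is the minimum of the ordinals β ≥ 1 with Σ⁰ β = Bor.

    HasLength : Carrier W → Set₁
    HasLength α = Positive W α × Σ⁰ α ≐ Bor ×
                  (∀ {β} → Positive W β → β < α → ¬ (Σ⁰ β ≐ Bor))

{-# OPTIONS --safe #-}
module Submission where
open import Defs
open import Level using (Level; 0ℓ; _⊔_; Lift; lift; lower)
open import Data.Bool using (Bool; true; false; T; if_then_else_)
open import Data.Bool.Properties using (T-irrelevant)
open import Data.Empty using (⊥; ⊥-elim)
open import Data.List using (List; []; _∷_; length)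
open import Data.Maybe using (just; nothing; Is-just)
open import Data.Maybe.Relation.Unary.Any using (just)
open import Data.Nat using (ℕ; zero; suc)
import Data.Nat as ℕ
import Data.Nat.Properties as ℕ
open import Data.Nat.GeneralisedArithmetic using (fold)
open import Data.Product.Relation.Binary.Lex.Strict using (×-Lex; ×-wellFounded)
import Relation.Binary.Construct.On as On
open import Data.Product using (Σ; ∃; ∃₂; _×_; _,_; proj₁; proj₂)
open import Data.Sum using (_⊎_; inj₁; inj₂; [_,_]′)
open import Data.Unit using (⊤; tt)
open import Function using (id; _∘_; case_of_)
open import Function.Bundles using (_↣_; Injection; mk↣)
open import Induction.WellFounded using (WellFounded; Acc; acc; module All; module FixPoint)
open import Relation.Binary.Core using (Rel)
open import Relation.Binary.Definitions using (Tri; tri<; tri≈; tri>)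
open import Relation.Binary.PropositionalEquality using (_≡_; _≢_; refl; sym; cong; subst)
import Relation.Binary.PropositionalEquality as ≡
open import Relation.Binary.Structures using (IsStrictTotalOrder)
open import Relation.Nullary using (¬_; Dec; yes; no; does; isYes)
open import Relation.Nullary.Decidable using (toWitness; fromWitness; True)
open import Relation.Unary using (Pred; U; ∅; ∁; _∈_; _∉_; _⊆_; _≐_; _∩_; _∪_; ⋃)

-- It suffices to find Borel sets R_s (s < κ) such that for all open sets O_s
-- (s < κ) some x satisfies x ∈ R_s ⇔ x ∈ O_s for every s.  Indeed, for fixed α
-- all Σ⁰_α sets arise from κ open sets by one and the same evaluation along a
-- well-founded tree; applied to the sets R_s it gives a Borel set H, and x
-- shows that the complement of H does not arise from any open sets O_s.
--
-- R_s says that the last mark which x carries for s has bit 1.  Given the sets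
-- O_s, the point x is constructed in κ stages, each fixing x on a set in 𝓘: at
-- stage s move into O_s if this is possible without new marks for earlier
-- labels, and then set a last mark for s that records the outcome.  The later
-- stages keep the positive outcomes as O_s is open, and the negative ones as x
-- itself adds no marks for the labels below s.
--
-- A mark must be an open condition that can be set outside any given set in 𝓘
-- and does not appear by accident at limits.  If there are disjoint sets T_k ∉ 𝓘
-- (k < κ), then a 1 in T_k is such a mark.  Otherwise 𝓘 is κ-saturated, so some
-- minimal function π makes it normal on a positive set N.  Modulo the sets that
-- are nonstationary along π, the members of 𝓘 then have no common bound, whereas
-- families of size κ do; a shortest unbounded family has a regular length
-- Θ > κ.  Assign to x the set of its ranks in Θ, that is, of the members of this
-- family which the ones of x meet in an essentially new nonthin set.  By
-- normality the ranks are stable at limits of length at most κ, and labels are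
-- read off from limit points of ranks in disjoint stationary subsets of Θ.

-- Classical logic, choice, and recursion with choice.

module Choice (cl : Classical) where
  open Classical cl

  private variable
    ℓ a b r : Level

  em : (A : Set ℓ) → Dec A
  em A = excludedMiddle

  abstract
    by-contra : {A : Set ℓ} → ¬ ¬ A → A
    by-contra {A = A} ¬¬a with em A
    ... | yes a = a
    ... | no ¬a = ⊥-elim (¬¬a ¬a)

  ¬∀⇒∃¬ : {A : Set a} {P : A → Set b} → ¬ (∀ x → P x) → ∃ λ x → ¬ P x
  ¬∀⇒∃¬ ¬∀ = by-contra λ ¬∃ → ¬∀ λ x → by-contra λ ¬Px → ¬∃ (x , ¬Px)

  -- A truth value of arbitrary level, resized to a type in Set with at most
  -- one element.

  abstract
    ⌊_⌋ : Set ℓ → Set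
    ⌊ A ⌋ = True (em A)

    wrap : {A : Set ℓ} → A → ⌊ A ⌋
    wrap = fromWitness

    unwrap : {A : Set ℓ} → ⌊ A ⌋ → A
    unwrap = toWitness

    ⌊⌋-irrelevant : {A : Set ℓ} (p q : ⌊ A ⌋) → p ≡ q
    ⌊⌋-irrelevant = T-irrelevant

  Σ⌊⌋-≡ : {A : Set a} {P : A → Set ℓ} {p q : Σ A λ x → ⌊ P x ⌋} → proj₁ p ≡ proj₁ q → p ≡ q
  Σ⌊⌋-≡ {p = x , p} {.x , q} refl = cong (x ,_) (⌊⌋-irrelevant p q)

  select : {A : Set a} (P : A → Set b) → A → A
  select P d with em (∃ P)
  ... | yes (x , _) = x
  ... | no _        = d

  select-holds : {A : Set a} (P : A → Set b) (d : A) → ∃ P → P (select P d)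
  select-holds P d ∃P with em (∃ P)
  ... | yes (x , Px) = Px
  ... | no ¬∃        = ⊥-elim (¬∃ ∃P)

  module _ {a r} {A : Set a} {_≺_ : Rel A r} (wf : WellFounded _≺_) where

    -- The requirement need be satisfiable only when the earlier values come
    -- from a total function.

    abstract
      recursive-choice : {B : Set b} (R : (x : A) → (∀ y → y ≺ x → B) → B → Set ℓ) → B →
                         (∀ x (h : A → B) → ∃ (R x (λ y _ → h y))) →
                         ∃ λ (g : A → B) → ∀ x → R x (λ y _ → g y) (g x)
      recursive-choice {b = b} {B = B} R base total = g , λ x →
        subst (R x (λ y _ → g y)) (sym (unfold {x})) (pick-holds x (λ y _ → g y) (em (∃ (Extends x (λ y _ → g y)))) (g , refl))
        where
        Extends : ∀ x → (∀ y → y ≺ x → B) → (A → B) → Set (a ⊔ r ⊔ b)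
        Extends x prev h = (λ y _ → h y) ≡ prev
        pick : ∀ x prev → Dec (∃ (Extends x prev)) → B
        pick x prev (yes (h , _)) = proj₁ (total x h)
        pick x prev (no _)        = base
        pick-holds : ∀ x prev d → ∃ (Extends x prev) → R x prev (pick x prev d)
        pick-holds x prev (yes (h , eq)) _ = subst (λ p → R x p (proj₁ (total x h))) eq (proj₂ (total x h))
        pick-holds x prev (no none)      e = ⊥-elim (none e)
        step : ∀ x → (∀ y → y ≺ x → B) → B
        step x prev = pick x prev (em (∃ (Extends x prev)))
        g : A → B
        g = All.wfRec wf b (λ _ → B) (λ x prev → step x (λ y y≺x → prev {y} y≺x))
        unfold : ∀ {x} → g x ≡ step x (λ y _ → g y)
        unfold = FixPoint.unfold-wfRec wf (λ _ → B) (λ x prev → step x (λ y y≺x → prev {y} y≺x))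
          λ x eq → cong (step x) (extensionality λ y → extensionality λ y≺x → eq y≺x)

    abstract
      minimal-element : ∀ {ℓ} (P : A → Set ℓ) → ∃ P → ∃ λ x → P x × (∀ y → y ≺ x → ¬ P y)
      minimal-element {ℓ} P (x , Px) = by-contra λ none →
        All.wfRec wf ℓ (λ x → ¬ P x) (λ x ih Px → none (x , Px , λ y y≺x → ih y≺x)) x Px

-- Well-orders and increasing enumerations.

module Order (cl : Classical) (W : WellOrder) where
  open Choice cl
  open WellOrder W public using (_<_; wellFounded)
  open IsStrictTotalOrder (WellOrder.isStrictTotalOrder W) public using (compare; irrefl) renaming (trans to <-trans)

  private C = Carrier W

  infix 4 _≤_

  _≤_ : Rel C 0ℓ
  x ≤ y = ¬ (y < x)

  <-irrefl : ∀ {x} → ¬ (x < x)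
  <-irrefl = irrefl refl

  ≤-refl : ∀ {x} → x ≤ x
  ≤-refl = <-irrefl

  <⇒≤ : ∀ {x y} → x < y → x ≤ y
  <⇒≤ x<y y<x = <-irrefl (<-trans x<y y<x)

  ≤⇒<⊎≡ : ∀ {x y} → x ≤ y → x < y ⊎ x ≡ y
  ≤⇒<⊎≡ {x} {y} x≤y with compare x y
  ... | tri< x<y _ _ = inj₁ x<y
  ... | tri≈ _ x≡y _ = inj₂ x≡y
  ... | tri> _ _ y<x = ⊥-elim (x≤y y<x)

  <-≤-trans : ∀ {x y z} → x < y → y ≤ z → x < z
  <-≤-trans x<y y≤z with ≤⇒<⊎≡ y≤z
  ... | inj₁ y<z  = <-trans x<y y<z
  ... | inj₂ refl = x<y

  ≤-<-trans : ∀ {x y z} → x ≤ y → y < z → x < z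
  ≤-<-trans x≤y y<z with ≤⇒<⊎≡ x≤y
  ... | inj₁ x<y  = <-trans x<y y<z
  ... | inj₂ refl = y<z

  ≤-trans : ∀ {x y z} → x ≤ y → y ≤ z → x ≤ z
  ≤-trans x≤y y≤z z<x = y≤z (<-≤-trans z<x x≤y)

  ≤-reflexive : ∀ {x y} → x ≡ y → x ≤ y
  ≤-reflexive refl = ≤-refl

  <⊎≥ : ∀ x y → x < y ⊎ y ≤ x
  <⊎≥ x y with em (x < y)
  ... | yes x<y = inj₁ x<y
  ... | no x≮y  = inj₂ x≮y

  ≤-total : ∀ x y → x ≤ y ⊎ y ≤ x
  ≤-total x y with <⊎≥ x y
  ... | inj₁ x<y = inj₁ (<⇒≤ x<y)
  ... | inj₂ y≤x = inj₂ y≤x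

  max : C → C → C
  max x y with <⊎≥ x y
  ... | inj₁ _ = y
  ... | inj₂ _ = x

  max-≤ˡ : ∀ x y → x ≤ max x y
  max-≤ˡ x y with <⊎≥ x y
  ... | inj₁ x<y = <⇒≤ x<y
  ... | inj₂ _   = ≤-refl

  max-≤ʳ : ∀ x y → y ≤ max x y
  max-≤ʳ x y with <⊎≥ x y
  ... | inj₁ _   = ≤-refl
  ... | inj₂ y≤x = y≤x

  max-< : ∀ {x y z} → x < z → y < z → max x y < z
  max-< {x} {y} x<z y<z with <⊎≥ x y
  ... | inj₁ _ = y<z
  ... | inj₂ _ = x<z

  least : ∀ {ℓ} (P : C → Set ℓ) → ∃ P → ∃ λ x → P x × (∀ y → y < x → ¬ P y)
  least = minimal-element wellFounded

module Enumeration (cl : Classical) (W : WellOrder) where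
  open Choice cl
  open Order cl W
  private C = Carrier W

  -- Each value is chosen in `G` above a bound for the values at all predecessors. The uses are the
  -- enumeration of pairs, with `G` everything, and that of the values with stationary fibres in
  -- Solovay's theorem.
  enumerate : ∀ {a r} {A : Set a} {_≺_ : Rel A r} → WellFounded _≺_ → C → (G : Pred C 0ℓ) →
              (∀ x (h : A → C) → ∃ λ β → ∀ {y} → y ≺ x → h y < β) →
              (∀ β → ∃ λ γ → G γ × β ≤ γ) →
              ∃ λ (g : A → C) → (∀ x → G (g x)) × (∀ {y x} → y ≺ x → g y < g x)
  enumerate {A = A} {_≺_} wf base G bounded unbounded =
    let (g , spec) = recursive-choice wf R base exists in
    g , (λ x → proj₁ (spec x)) , λ {y} {x} y≺x → proj₂ (spec x) y y≺x
    where
    R : (x : A) → (∀ y → y ≺ x → C) → C → Set _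
    R x prev γ = G γ × (∀ y y≺x → prev y y≺x < γ)
    exists : ∀ x h → ∃ (R x (λ y _ → h y))
    exists x h = let (β , below) = bounded x h ; (γ , Gγ , β≤γ) = unbounded β in
      γ , Gγ , λ y y≺x → <-≤-trans (below y≺x) β≤γ

-- Stationary subsets of regular ordinals and Solovay's theorem.

record Regular (W : WellOrder) : Set where
  open WellOrder W using (_<_)
  field
    unbounded : ∀ α → ∃ λ β → α < β
    bounded   : ∀ α (f : Carrier W → Carrier W) → ∃ λ β → ∀ {γ} → γ < α → f γ < β

module Stationarity (cl : Classical) (W : WellOrder) (regular : Regular W) where
  open Choice cl
  open Order cl W
  open Regular regular public
  private C = Carrier W

  bounded≤ : ∀ α (f : C → C) → ∃ λ β → ∀ {γ} → γ ≤ α → f γ < β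
  bounded≤ α f = let (α⁺ , α<α⁺) = unbounded α ; (β , f<β) = bounded α⁺ f in
    β , λ γ≤α → f<β (≤-<-trans γ≤α α<α⁺)

  abstract
    -- `h δ` is the least ordinal above `δ` and all `g γ` with `γ ≤ δ`; leastness makes `h`
    -- monotone.
    hull : (g : C → C) → ∃ λ (h : C → C) →
           (∀ δ ε → δ ≤ ε → h δ ≤ h ε) × (∀ δ → g δ < h δ) × (∀ δ → δ < h δ)
    hull g = h , (λ δ ε δ≤ε hε<hδ → proj₂ (spec δ) _ hε<hδ (restrict δ≤ε (proj₁ (spec ε)))) ,
             (λ δ → proj₂ (proj₁ (spec δ)) δ ≤-refl) , (λ δ → proj₁ (proj₁ (spec δ)))
      where
      Above : C → C → Set
      Above δ β = δ < β × (∀ γ → γ ≤ δ → g γ < β)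
      restrict : ∀ {δ ε β} → δ ≤ ε → Above ε β → Above δ β
      restrict δ≤ε (ε<β , g<β) = ≤-<-trans δ≤ε ε<β , λ γ γ≤δ → g<β γ (≤-trans γ≤δ δ≤ε)
      exists : ∀ δ → ∃ (Above δ)
      exists δ = let (β , g<β) = bounded≤ δ g ; (δ⁺ , δ<δ⁺) = unbounded δ in
        max δ⁺ β , <-≤-trans δ<δ⁺ (max-≤ˡ _ _) , λ γ γ≤δ → <-≤-trans (g<β γ≤δ) (max-≤ʳ _ _)
      h : C → C
      h δ = proj₁ (least (Above δ) (exists δ))
      spec : ∀ δ → Above δ (h δ) × (∀ β → β < h δ → ¬ Above δ β)
      spec δ = proj₂ (least (Above δ) (exists δ))

    -- Serves for diagonal intersections of clubs: a closure point of `h` is a closure point of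
    -- every `F ξ` with `ξ` below it.
    hull₂ : (F : C → C → C) → ∃ λ (h : C → C) → ∀ ξ γ δ → ξ ≤ δ → γ ≤ δ → F ξ γ < h δ
    hull₂ F = (λ δ → proj₁ (outer δ)) , λ ξ γ δ ξ≤δ γ≤δ →
      <-≤-trans (proj₂ (bounded≤ δ (F ξ)) γ≤δ) (<⇒≤ (proj₂ (outer δ) ξ≤δ))
      where
      outer : ∀ δ → ∃ λ β → ∀ {ξ} → ξ ≤ δ → proj₁ (bounded≤ δ (F ξ)) < β
      outer δ = bounded≤ δ λ ξ → proj₁ (bounded≤ δ (F ξ))

  Closed : (C → C) → Pred C 0ℓ
  Closed g α = Positive W α × (∀ δ → δ < α → g δ < α)

  closed-≤ : ∀ {g h} → (∀ δ → g δ ≤ h δ) → ∀ {α} → Closed h α → Closed g α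
  closed-≤ g≤h (pos , cl) = pos , λ δ δ<α → ≤-<-trans (g≤h δ) (cl δ δ<α)

  -- Clubs enter only as the sets of closure points of functions.

  Stationary : ∀ {ℓ} → Pred C ℓ → Set ℓ
  Stationary S = ∀ g → ∃ λ α → S α × Closed g α

  stationary-above : ∀ {ℓ} {S : Pred C ℓ} → Stationary S → ∀ g β → ∃ λ α → S α × Closed g α × β < α
  stationary-above stat g β =
    let (α , Sα , cl@((δ , δ<α) , closed)) = stat (λ δ → max (g δ) β) in
    α , Sα , closed-≤ (λ δ → max-≤ˡ _ _) cl , ≤-<-trans (max-≤ʳ (g δ) β) (closed δ δ<α)

  Cofinal : ∀ {ℓ} → Pred C ℓ → Pred C ℓ
  Cofinal D α = Positive W α × (∀ δ → δ < α → ∃ λ β → D β × δ < β × β < α)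

  -- Solovay's theorem.  Stationarily many α in S carry a cofinal set that no
  -- smaller point of S is a limit of; f picks a point of this set above a
  -- suitable fixed ξ.

  module _ {S : Pred C 0ℓ} (stat : Stationary S) where

    private
      Avoids : C → Pred C 0ℓ → Set
      Avoids α D = Cofinal D α × (∀ γ → γ < α → S γ → ¬ Cofinal D γ)

      Avoided : Pred C _
      Avoided α = S α × ∃ (Avoids α)

      module _ (g : C → C) where
        h : C → C
        h = proj₁ (hull g)
        h-mono : ∀ {δ ε} → δ ≤ ε → h δ ≤ h ε
        h-mono = proj₁ (proj₂ (hull g)) _ _
        h> : ∀ {δ} → δ < h δ
        h> = proj₂ (proj₂ (proj₂ (hull g))) _

        limit-closed : ∀ {γ} → Cofinal (Closed h) γ → Closed h γ
        limit-closed (pos , cof) = pos , λ δ δ<γ →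
          let (β , (_ , clβ) , δ<β , β<γ) = cof δ δ<γ in <-trans (clβ δ δ<β) β<γ

        module _ {α} (closed : Closed h α) (δ₀ : C) (δ₀<α : δ₀ < α)
                 (no-closed : ∀ γ → γ < α → δ₀ < γ → ¬ Closed h γ) where

          e : ℕ → C
          e zero    = δ₀
          e (suc n) = h (e n)

          Range : Pred C 0ℓ
          Range β = ∃ λ n → e n ≡ β

          e<α : ∀ n → e n < α
          e<α zero    = δ₀<α
          e<α (suc n) = proj₂ closed _ (e<α n)

          δ₀≤e : ∀ n → δ₀ ≤ e n
          δ₀≤e zero    = ≤-refl
          δ₀≤e (suc n) = ≤-trans (δ₀≤e n) (<⇒≤ h>)

          above-δ₀ : ∀ {γ} → Cofinal Range γ → δ₀ < γ
          above-δ₀ ((_ , δ<γ) , cof) with cof _ δ<γ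
          ... | _ , (n , refl) , _ , en<γ = ≤-<-trans (δ₀≤e n) en<γ

          e-mono : ∀ {m n} → m ℕ.≤ n → e m ≤ e n
          e-mono {n = n} ℕ.z≤n = δ₀≤e n
          e-mono (ℕ.s≤s m≤n)   = h-mono (e-mono m≤n)

          successor : ∀ {m n} → e m < e n → e (suc m) ≤ e n
          successor {m} {n} em<en with ℕ.<-cmp m n
          ... | tri< m<n _ _  = e-mono m<n
          ... | tri≈ _ refl _ = ⊥-elim (<-irrefl em<en)
          ... | tri> _ _ n<m  = ⊥-elim (e-mono (ℕ.<⇒≤ n<m) em<en)

          range-closed : ∀ {γ} → Cofinal Range γ → Closed h γ
          range-closed {γ} (pos , cof) = pos , closing
            where
            closing : ∀ δ → δ < γ → h δ < γ
            closing δ δ<γ with cof δ δ<γ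
            ... | _ , (m , refl) , δ<em , em<γ with cof _ em<γ
            ...   | _ , (n , refl) , em<en , en<γ =
              ≤-<-trans (h-mono (<⇒≤ δ<em)) (≤-<-trans (successor {m} {n} em<en) en<γ)

          -- Otherwise the supremum of the sequence is a closure point of `h` strictly between `δ₀`
          -- and `α`, which `no-closed` excludes.
          range-cofinal : Cofinal Range α
          range-cofinal = proj₁ closed , λ δ δ<α → by-contra λ none →
            let e<δ : ∀ n → e n < δ
                e<δ n = <-≤-trans h> (λ δ<e → none (e (suc n) , (suc n , refl) , δ<e , e<α (suc n)))
                (γ , e<γ , γ-least) = least (λ γ → ∀ n → e n < γ) (δ , e<δ)
                γ-closed : Closed h γ
                γ-closed = (δ₀ , e<γ 0) , λ ε ε<γ →
                  let (n , ε≤en) = ¬∀⇒∃¬ (γ-least ε ε<γ) in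
                  ≤-<-trans (h-mono ε≤en) (e<γ (suc n))
            in no-closed γ (≤-<-trans (λ δ<γ → γ-least δ δ<γ e<δ) δ<α) (e<γ 0) γ-closed

          range-avoids : Avoids α Range
          range-avoids = range-cofinal , λ γ γ<α Sγ cofγ → no-closed γ γ<α (above-δ₀ cofγ) (range-closed cofγ)

      -- The least closure point `α` of `h` in `S` works, with the cofinal set of all closure points
      -- of `h` or, when these are bounded below `α`, with the orbit of a bound `δ₀` under `h`. All
      -- limits of either set are closure points of `h`, so those below `α` are not in `S`.
      avoided-stationary : Stationary Avoided
      avoided-stationary g =
        let (α , (Sα , closed) , minimality) = least (λ α → S α × Closed (h g) α) (stat (h g)) in
        α , (Sα , avoids α Sα closed (λ γ γ<α Sγ clγ → minimality γ γ<α (Sγ , clγ))) ,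
        closed-≤ (λ δ → <⇒≤ (proj₁ (proj₂ (proj₂ (hull g))) δ)) closed
        where
        avoids : ∀ α → S α → Closed (h g) α → (∀ γ → γ < α → S γ → ¬ Closed (h g) γ) → ∃ (Avoids α)
        avoids α Sα closed minimality with em (Cofinal (Closed (h g)) α)
        ... | yes cof = Closed (h g) , cof , λ γ γ<α Sγ cofγ → minimality γ γ<α Sγ (limit-closed g cofγ)
        ... | no ¬cof =
          let (δ₀ , δ₀<α , no-closed) = gap in Range g closed δ₀ δ₀<α no-closed , range-avoids g closed δ₀ δ₀<α no-closed
          where
          gap : ∃ λ δ → δ < α × (∀ γ → γ < α → δ < γ → ¬ Closed (h g) γ)
          gap = by-contra λ none → ¬cof (proj₁ closed , λ δ δ<α → by-contra λ none′ →
            none (δ , δ<α , λ γ γ<α δ<γ clγ → none′ (γ , clγ , δ<γ , γ<α)))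

      next : C → C → C
      next ξ α with em (Avoided α) | em (ξ < α)
      ... | yes (_ , _ , (_ , cof) , _) | yes ξ<α = proj₁ (cof ξ ξ<α)
      ... | yes _                       | no _    = α
      ... | no _                        | _       = α

      next-between : ∀ {ξ α} → Avoided α → ξ < α → ξ < next ξ α × next ξ α < α
      next-between {ξ} {α} avd ξ<α with em (Avoided α) | em (ξ < α)
      ... | yes (_ , _ , (_ , cof) , _) | yes ξ<α′ = proj₂ (proj₂ (cof ξ ξ<α′))
      ... | yes _                       | no ξ≮α   = ⊥-elim (ξ≮α ξ<α)
      ... | no ¬avd                     | _        = ⊥-elim (¬avd avd)

      next-avoids : ∀ {α γ} → Avoided α → S γ → Positive W γ → γ < α → ¬ (∀ δ → δ < γ → next δ α < γ)
      next-avoids {α} {γ} avd Sγ pos γ<α below with em (Avoided α)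
      ... | no ¬avd = ¬avd avd
      ... | yes (_ , D , (_ , cof) , avoids) = avoids γ γ<α Sγ (pos , cofinal)
        where
        cofinal : ∀ δ → δ < γ → ∃ λ β → D β × δ < β × β < γ
        cofinal δ δ<γ with em (δ < α) | below δ δ<γ
        ... | yes δ<α | β<γ = let (Dβ , δ<β , _) = proj₂ (cof δ δ<α) in _ , Dβ , δ<β , β<γ
        ... | no δ≮α  | _   = ⊥-elim (δ≮α (<-trans δ<γ γ<α))

      Large : C → C → Pred C _
      Large ξ η α = Avoided α × ξ < α × η ≤ next ξ α

      -- Otherwise every `ξ` has some `η` with `next ξ α < η` for all relevant `α` in a club. Take
      -- `γ` closed under `ξ ↦ η` and a later `α` in the diagonal intersection of the clubs: then
      -- `next δ α < γ` for all `δ < γ`, against `next-avoids`.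
      good-index : ∃ λ ξ → ∀ η → Stationary (Large ξ η)
      good-index = by-contra λ none →
        let bad : ∀ ξ → ∃ λ η → ∃ λ g → ∀ α → ¬ (Large ξ η α × Closed g α)
            bad ξ = let (η , ¬stat) = ¬∀⇒∃¬ (λ st → none (ξ , st)) ; (g , ¬α) = ¬∀⇒∃¬ ¬stat in
              η , g , λ α p → ¬α (α , p)
            (h₁ , h₁>) = hull₂ λ ξ _ → proj₁ (bad ξ)
            (h₂ , h₂>) = hull₂ λ ξ → proj₁ (proj₂ (bad ξ))
            (γ , (Sγ , _) , (pos , clγ)) = avoided-stationary h₁
            (α , avd , (posα , clα) , γ<α) = stationary-above avoided-stationary h₂ γ
        in next-avoids avd Sγ pos γ<α λ δ δ<γ →
          let δ<α = <-trans δ<γ γ<α in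
          <-trans (by-contra {A = next δ α < proj₁ (bad δ)} λ η≤next →
                     proj₂ (proj₂ (bad δ)) α ((avd , δ<α , η≤next) , posα , λ ε ε<α →
                       <-trans (h₂> δ ε (max δ ε) (max-≤ˡ δ ε) (max-≤ʳ δ ε)) (clα _ (max-< δ<α ε<α))))
                  (<-trans (h₁> δ δ δ ≤-refl ≤-refl) (clγ δ δ<γ))

    abstract
      solovay : ∃ λ (f : C → C) → ∀ η → ∃ λ s → η ≤ s × Stationary (λ α → S α × f α ≡ s)
      solovay = let (ξ , large) = good-index in next ξ , λ η → by-contra λ none →
        -- Fodor's argument: if no fibre over any `s ≥ η` is stationary, an `α` in the diagonal
        -- intersection of the witnessing clubs is contradictory at its own value `next ξ α`, which
        -- lies below `α`.
        let bad : ∀ s → ∃ λ g → η ≤ s → ∀ α → ¬ ((S α × next ξ α ≡ s) × Closed g α)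
            bad s = by-contra λ ¬g → none (s ,
              (λ s<η → ¬g ((λ _ → s) , λ η≤s → ⊥-elim (η≤s s<η))) ,
              λ g → by-contra λ ¬α → ¬g (g , λ _ α p → ¬α (α , p)))
            (h , h>) = hull₂ λ s → proj₁ (bad s)
            (α , (avd , ξ<α , η≤s) , (pos , clα)) = large η h
            s<α = proj₂ (next-between avd ξ<α)
        in proj₂ (bad (next ξ α)) η≤s α ((proj₁ avd , refl) , pos , λ δ δ<α →
             <-trans (h> (next ξ α) δ (max _ δ) (max-≤ˡ _ δ) (max-≤ʳ _ δ)) (clα _ (max-< s<α δ<α)))

module StationaryParts (cl : Classical) (V W : WellOrder) (regular : Regular W) where
  open Order cl W
  open Stationarity cl W regular
  private module V = Order cl V

  abstract
    -- The values with stationary fibres are unbounded in `W`, so they can be enumerated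
    -- increasingly along `V`; fibres over distinct values are disjoint.
    stationary-parts : (∀ α (h : Carrier V → Carrier W) → ∃ λ β → ∀ {γ} → γ V.< α → h γ < β) →
                       ∀ {S : Pred (Carrier W) 0ℓ} → Stationary S → ∃ λ (T : Carrier V → Pred (Carrier W) 0ℓ) →
                       (∀ k → Stationary (T k)) × (∀ k γ → T k γ → S γ) × (∀ j k γ → T j γ → T k γ → j ≡ k)
    stationary-parts V-bounded {S} stat =
      let (f , fibres) = solovay stat
          (g , large , increasing) = Enumeration.enumerate cl W V.wellFounded (proj₁ (stat (λ δ → δ)))
            (λ s → Stationary (λ α → S α × f α ≡ s)) V-bounded
            (λ η → let (s , η≤s , stat′) = fibres η in s , stat′ , η≤s)
      in (λ k α → S α × f α ≡ g k) , large , (λ k γ → proj₁) , λ j k γ (_ , eq) (_ , eq′) →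
        case V.compare j k of λ where
          (tri< j<k _ _) → ⊥-elim (irrefl (≡.trans (sym eq) eq′) (increasing j<k))
          (tri≈ _ j≡k _) → j≡k
          (tri> _ _ k<j) → ⊥-elim (irrefl (≡.trans (sym eq′) eq) (increasing k<j))

-- Arithmetic of `κ`: numerals, pairs and lists coded as elements.

module Cardinal (cl : Classical) (κ : WellOrder) (uncountableRegular : IsUncountableRegular κ) where
  open Choice cl
  open Order cl κ
  open IsUncountableRegular uncountableRegular using (uncountable)

  private K = Carrier κ

  regularity : Regular κ
  regularity = record { unbounded = unbounded ; bounded = IsUncountableRegular.regular uncountableRegular }
    where
    unbounded : ∀ α → ∃ λ β → α < β
    -- Regularity for the constant function `α` says something only if there is an argument below
    -- `α`. A least `α` that is also the last would be the only element, against uncountability.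
    unbounded α with em (Positive κ α)
    ... | yes (γ , γ<α) = let (β , below) = IsUncountableRegular.regular uncountableRegular α (λ _ → α) in β , below γ<α
    ... | no zero-α = by-contra λ none →
      let only : ∀ β → β ≡ α
          only β = case compare β α of λ where
            (tri< β<α _ _) → ⊥-elim (zero-α (β , β<α))
            (tri≈ _ β≡α _) → β≡α
            (tri> _ _ α<β) → ⊥-elim (none (β , α<β))
      in uncountable (mk↣ {to = λ _ → 0} λ {β} {γ} _ → ≡.trans (only β) (sym (only γ)))

  open Stationarity cl κ regularity public

  private
    bottom : ∃ λ (α : K) → ∀ β → ¬ (β < α)
    bottom = let (α , _ , min) = least (λ _ → ⊤) (nonempty , tt) in α , λ β β<α → min β β<α tt
      where
      nonempty : K
      nonempty = by-contra λ ¬K → uncountable (mk↣ {to = λ _ → 0} λ {α} _ → ⊥-elim (¬K α))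

    successor : ∀ α → ∃ λ β → α < β × (∀ γ → γ < β → ¬ (α < γ))
    successor α = least (α <_) (unbounded α)

  nat : ℕ → K
  nat zero    = proj₁ bottom
  nat (suc n) = proj₁ (successor (nat n))

  nat-< : ∀ {m n} → m ℕ.< n → nat m < nat n
  nat-< {m} {suc n} (ℕ.s≤s m≤n) with ℕ.m≤n⇒m<n∨m≡n m≤n
  ... | inj₁ m<n  = <-trans (nat-< m<n) (proj₁ (proj₂ (successor (nat n))))
  ... | inj₂ refl = proj₁ (proj₂ (successor (nat n)))

  nat-injective : ∀ {m n} → nat m ≡ nat n → m ≡ n
  nat-injective {m} {n} eq with ℕ.<-cmp m n
  ... | tri< m<n _ _ = ⊥-elim (<-irrefl (subst (_< nat n) eq (nat-< m<n)))
  ... | tri≈ _ m≡n _ = m≡n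
  ... | tri> _ _ n<m = ⊥-elim (<-irrefl (subst (nat n <_) eq (nat-< n<m)))

  -- The numerals form an initial segment; if they were unbounded, every element would be a numeral
  -- and `κ` would be countable.
  omega : ∃ λ α → ∀ n → nat n < α
  omega = by-contra λ none →
    let index : ∀ α → ∃ λ n → nat n ≡ α
        index α = let (n , α≤n) = ¬∀⇒∃¬ (λ below → none (α , below)) in initial n α α≤n
    in uncountable (mk↣ {to = λ α → proj₁ (index α)} λ {α} {β} eq →
         ≡.trans (sym (proj₂ (index α))) (≡.trans (cong nat eq) (proj₂ (index β))))
    where
    initial : ∀ n α → α ≤ nat n → ∃ λ m → nat m ≡ α
    initial n α α≤n with ≤⇒<⊎≡ α≤n
    ... | inj₂ α≡n = n , sym α≡n
    initial zero    α _ | inj₁ α<0 = ⊥-elim (proj₂ bottom α α<0)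
    initial (suc n) α _ | inj₁ α<n = initial n α (proj₂ (proj₂ (successor (nat n))) α α<n)

  -- Families indexed by ℕ, seen as families indexed by the elements below ω.

  spread : ∀ {a} {A : Set a} → A → (ℕ → A) → K → A
  spread d f α with em (∃ λ n → nat n ≡ α)
  ... | yes (n , _) = f n
  ... | no _        = d

  spread-nat : ∀ {a} {A : Set a} (d : A) (f : ℕ → A) n → spread d f (nat n) ≡ f n
  spread-nat d f n with em (∃ λ m → nat m ≡ nat n)
  ... | yes (m , eq) = cong f (nat-injective eq)
  ... | no ¬m        = ⊥-elim (¬m (n , refl))

  private
    Key : Set
    Key = K × K × K

    key : K × K → Key
    key (α , β) = max α β , α , β

    _≺_ : Rel (K × K) _
    p ≺ q = ×-Lex _≡_ _<_ (×-Lex _≡_ _<_ _<_) (key p) (key q)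

    ≺-wellFounded : WellFounded _≺_
    ≺-wellFounded = On.wellFounded key (×-wellFounded wellFounded (×-wellFounded wellFounded wellFounded))

    ≺-connex : ∀ p q → p ≺ q ⊎ p ≡ q ⊎ q ≺ p
    ≺-connex (α , β) (γ , δ) with compare (max α β) (max γ δ)
    ... | tri< lt _ _ = inj₁ (inj₁ lt)
    ... | tri> _ _ gt = inj₂ (inj₂ (inj₁ gt))
    ... | tri≈ _ eq _ with compare α γ
    ...   | tri< lt _ _ = inj₁ (inj₂ (eq , inj₁ lt))
    ...   | tri> _ _ gt = inj₂ (inj₂ (inj₂ (sym eq , inj₁ gt)))
    ...   | tri≈ _ refl _ with compare β δ
    ...     | tri< lt _ _   = inj₁ (inj₂ (eq , inj₂ (refl , lt)))
    ...     | tri> _ _ gt   = inj₂ (inj₂ (inj₂ (sym eq , inj₂ (refl , gt))))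
    ...     | tri≈ _ refl _ = inj₂ (inj₁ refl)

    ≺-bounded : ∀ p (h : K × K → K) → ∃ λ β → ∀ {q} → q ≺ p → h q < β
    ≺-bounded (α , β) h = let (H , h<H) = hull₂ (λ γ δ → h (γ , δ)) in
      H m , λ {q} q≺p → h<H _ _ m (≤-trans (max-≤ˡ _ _) (max≤m q q≺p)) (≤-trans (max-≤ʳ _ _) (max≤m q q≺p))
      where
      m = max α β
      max≤m : ∀ q → q ≺ (α , β) → max (proj₁ q) (proj₂ q) ≤ m
      max≤m q (inj₁ lt)       = <⇒≤ lt
      max≤m q (inj₂ (eq , _)) = ≤-reflexive eq

  -- The canonical well-ordering of pairs shows that κ · κ = κ.

  abstract
    pairing : (K × K) ↣ K
    pairing = let (g , _ , increasing) = Enumeration.enumerate cl κ ≺-wellFounded (nat 0) (λ _ → ⊤) ≺-bounded (λ β → β , tt , ≤-refl) in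
      mk↣ {to = g} λ {p} {q} eq → case ≺-connex p q of λ where
        (inj₁ p≺q)        → ⊥-elim (<-irrefl (subst (_< g q) eq (increasing p≺q)))
        (inj₂ (inj₁ p≡q)) → p≡q
        (inj₂ (inj₂ q≺p)) → ⊥-elim (<-irrefl (subst (g q <_) eq (increasing q≺p)))

  pair : K → K → K
  pair α β = Injection.to pairing (α , β)

  pair-injective : ∀ {α β γ δ} → pair α β ≡ pair γ δ → α ≡ γ × β ≡ δ
  pair-injective eq with Injection.injective pairing eq
  ... | refl = refl , refl

  bit : Bool → K
  bit true  = nat 0
  bit false = nat 1

  bit-injective : ∀ {b c} → bit b ≡ bit c → b ≡ c
  bit-injective {true}  {true}  _ = refl
  bit-injective {true}  {false} eq = case nat-injective {0} {1} eq of λ ()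
  bit-injective {false} {true}  eq = case nat-injective {1} {0} eq of λ ()
  bit-injective {false} {false} _ = refl

  -- Injective only among lists of a fixed length, because the code of the empty list may also be a
  -- pair; `address` therefore records the length.
  tuple : List (K × K) → K
  tuple []            = nat 0
  tuple ((α , β) ∷ l) = pair (pair α β) (tuple l)

  tuple-injective : ∀ k l → length k ≡ length l → tuple k ≡ tuple l → k ≡ l
  tuple-injective []            []            _  _  = refl
  tuple-injective ((α , β) ∷ k) ((γ , δ) ∷ l) eq eq′ with pair-injective eq′
  ... | p , q with pair-injective p
  ...   | refl , refl = cong ((α , β) ∷_) (tuple-injective k l (ℕ.suc-injective eq) q)

  address : List (K × K) → Bool → K
  address l b = pair (bit b) (pair (nat (length l)) (tuple l))

  address-injective : ∀ {k l b c} → address k b ≡ address l c → k ≡ l × b ≡ c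
  address-injective {k} {l} eq with pair-injective eq
  ... | p , q with pair-injective q
  ...   | r , s = tuple-injective k l (nat-injective r) s , bit-injective p

-- The topology of the ideal: open sets are the locally determined ones.

module Space (cl : Classical) (κ : WellOrder) (uncountableRegular : IsUncountableRegular κ)
             (𝓘 : Family (Carrier κ)) (ideal : IsCompleteProperIdeal κ 𝓘) (containsBounded : ContainsBounded κ 𝓘)
             (ν : Base) where
  open Choice cl public
  open Order cl κ public
  open Cardinal cl κ uncountableRegular public
  open Hierarchy κ 𝓘 ν public
  open IsCompleteProperIdeal ideal public using (empty; downward; proper; complete) renaming (union to ∪-small)

  digit : (μ : Base) → Bool → ⟦ μ ⟧
  digit two   b = b
  digit kappa b = bit b

  digit-injective : ∀ μ {b c} → digit μ b ≡ digit μ c → b ≡ c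
  digit-injective two   = id
  digit-injective kappa = bit-injective

  off on : ⟦ ν ⟧
  off = digit ν false
  on  = digit ν true

  on≢off : on ≢ off
  on≢off eq = case digit-injective ν eq of λ ()

  singleton-small : ∀ γ → (_≡ γ) ∈ 𝓘
  singleton-small γ = containsBounded _ (let (β , γ<β) = unbounded γ in β , λ { refl → γ<β })

  ⋃<-small : ∀ {t} (D : K → Pred K 0ℓ) → (∀ u → u < t → D u ∈ 𝓘) → (λ p → ∃ λ u → u < t × D u p) ∈ 𝓘
  ⋃<-small D small = complete _ D λ {u} u<t → small u u<t

  ⋃ℕ-small : (D : ℕ → Pred K 0ℓ) → (∀ n → D n ∈ 𝓘) → ⋃ ℕ D ∈ 𝓘
  ⋃ℕ-small D small = let (ω , below) = omega in
    downward (λ {p} (n , Dnp) → nat n , below n , subst (λ E → E p) (sym (spread-nat ∅ D n)) Dnp)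
             (⋃<-small (spread ∅ D) λ u _ → spread-small u)
    where
    spread-small : ∀ u → spread ∅ D u ∈ 𝓘
    spread-small u with em (∃ λ n → nat n ≡ u)
    ... | yes (n , _) = small n
    ... | no _        = empty

  Agree : Pred K 0ℓ → Rel Space 0ℓ
  Agree D x y = ∀ p → D p → x p ≡ y p

  agree-trans : ∀ {D E x y z} → Agree D x y → D ⊆ E → Agree E y z → Agree D x z
  agree-trans x≈y D⊆E y≈z p Dp = ≡.trans (x≈y p Dp) (y≈z p (D⊆E Dp))

  -- Since `𝓘` is closed under finite unions, the sets `𝐍 f` form a base, so openness of `A` amounts
  -- to this condition at every point of `A`.
  Local : Pred Space 0ℓ → Space → Set₁
  Local A x = ∃ λ D → D ∈ 𝓘 × (∀ y → Agree D x y → A y)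

  open⇒local : ∀ {A} → A ∈ Open → ∀ x → A x → Local A x
  open⇒local (basic (f , small , A⊆N , N⊆A)) x Ax =
    dom f , small , λ y x≈y → N⊆A λ γ i fγ≡i → ≡.trans (sym (x≈y γ (subst Is-just (sym fγ≡i) (just tt)))) (A⊆N Ax γ i fγ≡i)
  open⇒local whole x _ = ∅ , empty , λ _ _ → tt
  open⇒local (inter o o′) x (Ax , A′x) =
    let (D , small , loc) = open⇒local o x Ax ; (D′ , small′ , loc′) = open⇒local o′ x A′x in
    D ∪ D′ , ∪-small small small′ , λ y x≈y → loc y (λ p → x≈y p ∘ inj₁) , loc′ y (λ p → x≈y p ∘ inj₂)
  open⇒local (union A o) x (j , Ax) = let (D , small , loc) = open⇒local (o j) x Ax in D , small , λ y x≈y → j , loc y x≈y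
  open⇒local (resp (A⊆B , B⊆A) o) x Bx = let (D , small , loc) = open⇒local o x (B⊆A Bx) in D , small , λ y x≈y → A⊆B (loc y x≈y)

  Restriction : Space → Pred K 0ℓ → PartialFunction
  Restriction x D p with em (D p)
  ... | yes _ = just (x p)
  ... | no _  = nothing

  restriction-dom : ∀ x D → dom (Restriction x D) ⊆ D
  restriction-dom x D {p} def with em (D p)
  restriction-dom x D {p} def | yes Dp = Dp
  restriction-dom x D {p} ()  | no _

  restriction-∈ : ∀ {x D y} → Agree D x y → 𝐍 (Restriction x D) y
  restriction-∈ {x} {D} x≈y p i eq with em (D p)
  restriction-∈ {x} {D} x≈y p i refl | yes Dp = sym (x≈y p Dp)
  restriction-∈ {x} {D} x≈y p i ()   | no _

  restriction-agree : ∀ {x D y} → 𝐍 (Restriction x D) y → Agree D x y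
  restriction-agree {x} {D} y∈ p Dp = sym (y∈ p (x p) defined)
    where
    defined : Restriction x D p ≡ just (x p)
    defined with em (D p)
    ... | yes _ = refl
    ... | no ¬D = ⊥-elim (¬D Dp)

  local⇒open : ∀ {A} → (∀ x → A x → Local A x) → A ∈ Open
  local⇒open {A} loc = Generated.resp
    ((λ {y} ((x , Ax) , y∈) → proj₂ (proj₂ (loc x Ax)) y (restriction-agree y∈)) ,
     λ {y} Ay → (y , Ay) , restriction-∈ λ _ _ → refl)
    (Generated.union {J = ∃ A} (λ (x , Ax) → 𝐍 (Restriction x (proj₁ (loc x Ax)))) λ (x , Ax) →
      basic (_ , downward (λ {p} → restriction-dom x (proj₁ (loc x Ax)) {p}) (proj₁ (proj₂ (loc x Ax))) , (λ {_} y∈ → y∈) , λ {_} y∈ → y∈))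

-- Construction of the diagonal point from an abstract system of marks.

module Diagonal (cl : Classical) (κ : WellOrder) (uncountableRegular : IsUncountableRegular κ)
                (𝓘 : Family (Carrier κ)) (ideal : IsCompleteProperIdeal κ 𝓘) (containsBounded : ContainsBounded κ 𝓘)
                (ν : Base) where
  open Space cl κ uncountableRegular 𝓘 ideal containsBounded ν

  -- A stage of the construction of a point: what is decided so far is the
  -- restriction of `point` to `domain`.  A mark with index `level` has been set
  -- for the label handled at this stage, and `answer` is the bit it carries.

  record Stage : Set₁ where
    field
      point  : Space
      domain : Pred K 0ℓ
      level  : K
      answer : Bool

  open Stage

  -- What a system of marks may use about the stages when it handles a limit. Points of `early t`
  -- undecided before stage `t` are off there; `Sealed` relates `base`, the set respected when the
  -- mark was set, to the new point and domain.
  record Coherent (early : K → Pred K 0ℓ) (Sealed : Pred K 0ℓ → Space → Pred K 0ℓ → Set₁)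
                  (t : K) (prev : ∀ u → u < t → Stage) (s : Stage) : Set₁ where
    field
      small     : domain s ∈ 𝓘
      supported : ∀ p → ¬ domain s p → point s p ≡ off
      later     : ∀ u u<t → domain (prev u u<t) ⊆ domain s
      agree     : ∀ u u<t → Agree (domain (prev u u<t)) (point (prev u u<t)) (point s)
      delayed   : ∀ p → early t p → (∀ u u<t → ¬ domain (prev u u<t) p) → point s p ≡ off
      base      : Pred K 0ℓ
      base-⊇    : ∀ u u<t → domain (prev u u<t) ⊆ base
      sealed    : Sealed base (point s) (domain s)

  -- Marks are open conditions that can be imposed one at a time and of which
  -- none appears by accident at limits.

  record Marks : Set₂ where
    field
      early       : K → Pred K 0ℓ
      early-small : ∀ t → early t ∈ 𝓘
      Good        : Pred Space 0ℓ
      Mark        : K → Pred Space 0ℓ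
      Sealed      : Pred K 0ℓ → Space → Pred K 0ℓ → Set₁
      mark-local  : ∀ k x → Mark k x → Local (Mark k) x
      set-mark    : ∀ y → Good y → ∀ D → D ∈ 𝓘 → ∀ k → ∃₂ λ x E →
                    D ⊆ E × E ∈ 𝓘 × Agree D y x × (∀ p → ¬ E p → x p ≡ off) × Good x × Sealed D x E ×
                    (∀ z → Agree E x z → Mark k z) × (∀ j → Mark j x → j ≡ k ⊎ Mark j y)
      limit       : (J : Pred K 0ℓ) → (∀ {u t} → J t → u < t → J u) → (h : K → Stage) →
                    (∀ t → J t → Coherent early Sealed t (λ u _ → h u) (h t)) →
                    ∀ x → (∀ t → J t → Agree (domain (h t)) (point (h t)) x) →
                    (∀ p → (∀ t → J t → ¬ domain (h t) p) → x p ≡ off) →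
                    Good x × (∀ k → Mark k x → ∃ λ t → J t × (∀ u → J u → t ≤ u → Mark k (point (h u))))

  module _ (marks : Marks) where
    open Marks marks

    private
      label : K → K → Bool → K
      label s j b = pair s (pair j (bit b))

      label-injective : ∀ {s s′ j j′ b b′} → label s j b ≡ label s′ j′ b′ → s ≡ s′ × j ≡ j′ × b ≡ b′
      label-injective eq = let (p , q) = pair-injective eq ; (r , t) = pair-injective q in p , r , bit-injective t

    Read : K → Pred Space 0ℓ
    Read s x = ∃ λ j → Mark (label s j true) x × (∀ j′ b → j < j′ → ¬ Mark (label s j′ b) x)

    private
      Legal : Pred Space 0ℓ
      Legal y = Good y × (∀ s → ∃ λ β → ∀ j b → Mark (label s j b) y → j < β)

      -- Marks for `s` with index below `j` are tolerated, since `Read` looks only at the last one.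
      Keeps : K → K → Bool → Pred Space 0ℓ
      Keeps s j b y = ∀ j′ b′ → Mark (label s j′ b′) y → j′ < j ⊎ (j′ ≡ j × b′ ≡ b)

      module _ (O : K → Pred Space 0ℓ) (O-local : ∀ s x → O s x → Local (O s) x) where

        Continues : (t : K) → (∀ u → u < t → Stage) → Pred Space 0ℓ
        Continues t prev y =
          Legal y × (∀ u u<t → Keeps u (level (prev u u<t)) (answer (prev u u<t)) y) ×
          (∀ u u<t → Agree (domain (prev u u<t)) (point (prev u u<t)) y) ×
          (∀ p → early t p ⊎ p ≡ t → (∀ u u<t → ¬ domain (prev u u<t) p) → y p ≡ off)

        record Spec (t : K) (prev : ∀ u → u < t → Stage) (s : Stage) : Set₁ where
          field
            coherent  : Coherent early Sealed t prev s
            continues : Continues t prev (point s)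
            keeps     : Keeps t (level s) (answer s) (point s)
            reached   : ∀ p → early t p ⊎ p ≡ t → domain s p
            marked    : ∀ z → Agree (domain s) (point s) z → Mark (label t (level s) (answer s)) z
            accept    : answer s ≡ true → ∀ z → Agree (domain s) (point s) z → O t z
            reject    : answer s ≡ false → ∀ y → Continues t prev y → ¬ O t y

        -- `recursive-choice` asks for a value after arbitrary earlier values, so the specification
        -- is conditional on theirs; the induction in `specs` removes the condition.
        Requirement : (t : K) → (∀ u → u < t → Stage) → Stage → Set₁
        Requirement t prev s = (∀ u u<t → Spec u (λ v v<u → prev v (<-trans v<u u<t)) (prev u u<t)) → Spec t prev s

        module Step (t : K) (h : K → Stage) (specs : ∀ u → u < t → Spec u (λ v _ → h v) (h u)) where

          private
            prev : ∀ u → u < t → Stage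
            prev u _ = h u

            coherentAt : ∀ u → u < t → Coherent early Sealed u (λ v _ → h v) (h u)
            coherentAt u u<t = Spec.coherent (specs u u<t)

          agree≤ : ∀ {u v} → u ≤ v → v < t → domain (h u) ⊆ domain (h v) × Agree (domain (h u)) (point (h u)) (point (h v))
          agree≤ u≤v v<t with ≤⇒<⊎≡ u≤v
          ... | inj₁ u<v  = Coherent.later (coherentAt _ v<t) _ u<v , Coherent.agree (coherentAt _ v<t) _ u<v
          ... | inj₂ refl = id , λ _ _ → refl

          limitPoint : Space
          limitPoint p with em (∃ λ u → u < t × domain (h u) p)
          ... | yes (u , _) = point (h u) p
          ... | no _        = off

          limitPoint-agree : ∀ u → u < t → Agree (domain (h u)) (point (h u)) limitPoint
          limitPoint-agree u u<t p Dup with em (∃ λ u → u < t × domain (h u) p)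
          ... | no none = ⊥-elim (none (u , u<t , Dup))
          ... | yes (v , v<t , Dvp) with ≤-total u v
          ...   | inj₁ u≤v = proj₂ (agree≤ u≤v v<t) p Dup
          ...   | inj₂ v≤u = sym (proj₂ (agree≤ v≤u u<t) p Dvp)

          limitPoint-off : ∀ p → (∀ u → u < t → ¬ domain (h u) p) → limitPoint p ≡ off
          limitPoint-off p out with em (∃ λ u → u < t × domain (h u) p)
          ... | no _                = refl
          ... | yes (u , u<t , Dup) = ⊥-elim (out u u<t Dup)

          limits : Good limitPoint × (∀ k → Mark k limitPoint → ∃ λ v → v < t × (∀ u → u < t → v ≤ u → Mark k (point (h u))))
          limits = limit (_< t) (λ v<t u<v → <-trans u<v v<t) h coherentAt limitPoint limitPoint-agree limitPoint-off

          bounds : ∀ s u → ∃ λ β → u < t → ∀ j b → Mark (label s j b) (point (h u)) → j < β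
          bounds s u with em (u < t)
          ... | yes u<t = let (β , below) = proj₂ (proj₁ (Spec.continues (specs u u<t))) s in β , λ _ → below
          ... | no u≮t  = t , λ u<t → ⊥-elim (u≮t u<t)

          -- A mark of the limit is present at some earlier stage, where its index is bounded; by
          -- regularity the bounds of fewer than `κ` stages have a common bound.
          limitPoint-legal : Legal limitPoint
          limitPoint-legal = proj₁ limits , λ s →
            let (β , bound<β) = bounded t (λ u → proj₁ (bounds s u)) in
            β , λ j b m → let (v , v<t , persists) = proj₂ limits _ m in
              <-trans (proj₂ (bounds s v) v<t j b (persists v v<t ≤-refl)) (bound<β v<t)

          keeps≤ : ∀ {u v} → u ≤ v → v < t → Keeps u (level (h u)) (answer (h u)) (point (h v))
          keeps≤ u≤v v<t with ≤⇒<⊎≡ u≤v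
          ... | inj₁ u<v  = proj₁ (proj₂ (Spec.continues (specs _ v<t))) _ u<v
          ... | inj₂ refl = Spec.keeps (specs _ v<t)

          -- A mark of the limit is present at all stages from some `v` on, hence at `max u v`,
          -- where the restriction of stage `u` is in force. This one union serves at initial,
          -- successor and limit stages alike.
          limitPoint-continues : Continues t prev limitPoint
          limitPoint-continues = limitPoint-legal ,
            (λ u u<t j b m → let (v , v<t , persists) = proj₂ limits _ m in
              keeps≤ (max-≤ˡ u v) (max-< u<t v<t) j b (persists (max u v) (max-< u<t v<t) (max-≤ʳ u v))) ,
            limitPoint-agree , λ p _ → limitPoint-off p

          Din : Pred K 0ℓ
          Din p = (∃ λ u → u < t × domain (h u) p) ⊎ early t p ⊎ p ≡ t

          Din-small : Din ∈ 𝓘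
          Din-small = ∪-small (⋃<-small (λ u → domain (h u)) λ u u<t → Coherent.small (coherentAt u u<t))
                              (∪-small (early-small t) (singleton-small t))

          finish : ∀ y → Continues t prev y → ∀ D → D ∈ 𝓘 → Din ⊆ D → (b : Bool) →
                   (b ≡ true → ∀ z → Agree D y z → O t z) →
                   (b ≡ false → ∀ y → Continues t prev y → ¬ O t y) →
                   ∃ (Spec t prev)
          finish y (legal@(good , levels) , keeps , agrees , offs) D small Din⊆D b accept reject =
            -- `j` exceeds the index of every mark for `t` in `y`, so the mark set now becomes the
            -- last one.
            let (j , below) = levels t
                (x , E , D⊆E , E-small , y≈x , supported , good′ , sealed , marked , only) = set-mark y good D small (label t j b)
                old : ∀ s j′ b′ → Mark (label s j′ b′) x → (s ≡ t × j′ ≡ j × b′ ≡ b) ⊎ Mark (label s j′ b′) y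
                old s j′ b′ m = case only _ m of λ where
                  (inj₁ eq) → inj₁ (label-injective {b = b′} {b′ = b} eq)
                  (inj₂ m′) → inj₂ m′
                before : ∀ {u p} → u < t → domain (h u) p → D p
                before u<t Dup = Din⊆D (inj₁ (_ , u<t , Dup))
            in record { point = x ; domain = E ; level = j ; answer = b } , record
              { coherent  = record
                { small     = E-small
                ; supported = supported
                ; later     = λ u u<t Dup → D⊆E (before u<t Dup)
                ; agree     = λ u u<t p Dup → ≡.trans (agrees u u<t p Dup) (y≈x p (before u<t Dup))
                ; delayed   = λ p ep out → ≡.trans (sym (y≈x p (Din⊆D (inj₂ (inj₁ ep))))) (offs p (inj₁ ep) out)
                ; base      = D
                ; base-⊇    = λ u u<t → before u<t
                ; sealed    = sealed
                }
              ; continues =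
                (good′ , λ s → let (β , below′) = levels s ; (j⁺ , j<j⁺) = unbounded j in
                  max j⁺ β , λ j′ b′ m → case old _ j′ b′ m of λ where
                    (inj₁ (_ , refl , _)) → <-≤-trans j<j⁺ (max-≤ˡ j⁺ β)
                    (inj₂ m′)             → <-≤-trans (below′ j′ b′ m′) (max-≤ʳ j⁺ β)) ,
                (λ u u<t j′ b′ m → case old u j′ b′ m of λ where
                    (inj₁ (refl , _)) → ⊥-elim (<-irrefl u<t)
                    (inj₂ m′)         → keeps u u<t j′ b′ m′) ,
                (λ u u<t p Dup → ≡.trans (agrees u u<t p Dup) (y≈x p (before u<t Dup))) ,
                λ p ep out → ≡.trans (sym (y≈x p (Din⊆D (inj₂ ep)))) (offs p ep out)
              ; keeps     = λ j′ b′ m → case old _ j′ b′ m of λ where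
                    (inj₁ (_ , eq , eq′)) → inj₂ (eq , eq′)
                    (inj₂ m′)             → inj₁ (below j′ b′ m′)
              ; reached   = λ p ep → D⊆E (Din⊆D (inj₂ ep))
              ; marked    = marked
              ; accept    = λ eq z x≈z → accept eq z (agree-trans {E = E} y≈x (λ {p} → D⊆E {p}) x≈z)
              ; reject    = reject
              }

          next-stage : ∃ (Spec t prev)
          next-stage with em (∃ λ y → Continues t prev y × O t y)
          -- `D` secures membership in `O t`; once it is part of the domain, all later points stay
          -- in `O t`.
          ... | yes (y , cont , Oty) = let (D , small , local) = O-local t y Oty in
            finish y cont (Din ∪ D) (∪-small Din-small small) inj₁ true (λ _ z y≈z → local z λ p → y≈z p ∘ inj₂) λ ()
          ... | no none = finish limitPoint limitPoint-continues Din Din-small id false (λ ()) λ _ y cont Oty → none (y , cont , Oty)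

        run : ∃ λ h → ∀ t → Requirement t (λ u _ → h u) (h t)
        run = recursive-choice wellFounded Requirement dummy λ t h → total t h
          where
          dummy : Stage
          dummy = record { point = λ _ → off ; domain = ∅ ; level = nat 0 ; answer = false }
          total : ∀ t h → ∃ (Requirement t (λ u _ → h u))
          total t h with em (∀ u → u < t → Spec u (λ v _ → h v) (h u))
          ... | yes specs = let (s , spec) = Step.next-stage t h specs in s , λ _ → spec
          ... | no ¬specs = dummy , λ specs → ⊥-elim (¬specs specs)

        h : K → Stage
        h = proj₁ run

        specs : ∀ t → Spec t (λ u _ → h u) (h t)
        specs = All.wfRec wellFounded _ (λ t → Spec t (λ u _ → h u) (h t)) λ t ih → proj₂ run t λ u u<t → ih u<t

        -- Stage `t` decides the coordinate `t` by `reached`, so every coordinate is decided.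
        final : Space
        final t = point (h t) t

        agree-ordered : ∀ {u v} → u < v → domain (h u) ⊆ domain (h v) × Agree (domain (h u)) (point (h u)) (point (h v))
        agree-ordered u<v = Coherent.later (Spec.coherent (specs _)) _ u<v , Coherent.agree (Spec.coherent (specs _)) _ u<v

        final-agree : ∀ u → Agree (domain (h u)) (point (h u)) final
        final-agree u p Dup with compare u p
        ... | tri< u<p _ _  = proj₂ (agree-ordered u<p) p Dup
        ... | tri≈ _ refl _ = refl
        ... | tri> _ _ p<u  = sym (proj₂ (agree-ordered p<u) p (Spec.reached (specs p) p (inj₂ refl)))

        final-limits : Good final × (∀ k → Mark k final → ∃ λ v → ⊤ × (∀ u → ⊤ → v ≤ u → Mark k (point (h u))))
        final-limits = limit (λ _ → ⊤) (λ _ _ → tt) h (λ t _ → Spec.coherent (specs t)) final (λ t _ → final-agree t)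
                             λ p out → ⊥-elim (out p tt (Spec.reached (specs p) p (inj₂ refl)))

        keeps-ordered : ∀ {u v} → u ≤ v → Keeps u (level (h u)) (answer (h u)) (point (h v))
        keeps-ordered u≤v with ≤⇒<⊎≡ u≤v
        ... | inj₁ u<v  = proj₁ (proj₂ (Spec.continues (specs _))) _ u<v
        ... | inj₂ refl = Spec.keeps (specs _)

        final-keeps : ∀ u → Keeps u (level (h u)) (answer (h u)) final
        final-keeps u j b m = let (v , _ , persists) = proj₂ final-limits _ m in
          keeps-ordered (max-≤ˡ u v) j b (persists (max u v) tt (max-≤ʳ u v))

        -- The final point is itself a candidate at every stage, so it is not in any `O t` that
        -- stage `t` rejected. This secures the negative answers, for which there is no open
        -- condition.
        final-continues : ∀ t → Continues t (λ u _ → h u) final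
        final-continues t =
          (proj₁ final-limits , λ s → let (j⁺ , j<j⁺) = unbounded (level (h s)) in
            j⁺ , λ j b m → case final-keeps s j b m of λ where
              (inj₁ j<)        → <-trans j< j<j⁺
              (inj₂ (refl , _)) → j<j⁺) ,
          (λ u _ → final-keeps u) , (λ u _ → final-agree u) , λ p ep out →
            ≡.trans (sym (final-agree t p (Spec.reached (specs t) p ep)))
                    (proj₂ (proj₂ (proj₂ (Spec.continues (specs t)))) p ep out)

        final-marked : ∀ t → Mark (label t (level (h t)) (answer (h t))) final
        final-marked t = Spec.marked (specs t) final (final-agree t)

        read⇔ : ∀ t → (Read t final → O t final) × (O t final → Read t final)
        read⇔ t with answer (h t) in eq | final-marked t | final-keeps t
        ... | true  | m | keeps = (λ _ → Spec.accept (specs t) eq final (final-agree t)) , λ _ →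
          level (h t) , m , λ j′ b j<j′ m′ → case keeps j′ b m′ of λ where
            (inj₁ j′<j)       → <-irrefl (<-trans j<j′ j′<j)
            (inj₂ (refl , _)) → <-irrefl j<j′
        ... | false | m | keeps = (λ (j , m′ , last) → case keeps j true m′ of λ where
            (inj₁ j<)       → ⊥-elim (last (level (h t)) false j< m)
            (inj₂ (_ , ()))) , λ Ot → ⊥-elim (Spec.reject (specs t) eq final (final-continues t) Ot)

    abstract
      fixed-point : (O : K → Pred Space 0ℓ) → (∀ s → O s ∈ Open) →
                    ∃ λ x → ∀ s → (Read s x → O s x) × (O s x → Read s x)
      fixed-point O O-open = final O local , read⇔ O local
        where
        local : ∀ s x → O s x → Local (O s) x
        local s = open⇒local (O-open s)

-- Marks from `κ` disjoint positive sets.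

module DisjointPositive (cl : Classical) (κ : WellOrder) (uncountableRegular : IsUncountableRegular κ)
                        (𝓘 : Family (Carrier κ)) (ideal : IsCompleteProperIdeal κ 𝓘) (containsBounded : ContainsBounded κ 𝓘)
                        (ν : Base) where
  open Space cl κ uncountableRegular 𝓘 ideal containsBounded ν
  open Diagonal cl κ uncountableRegular 𝓘 ideal containsBounded ν

  overwrite : Pred K 0ℓ → Space → Pred K 0ℓ → Space
  overwrite D y a p with em (D p) | em (a p)
  ... | yes _ | _     = y p
  ... | no _  | yes _ = on
  ... | no _  | no _  = off

  overwrite-agree : ∀ D y a → Agree D y (overwrite D y a)
  overwrite-agree D y a p Dp with em (D p) | em (a p)
  ... | yes _ | _ = refl
  ... | no ¬D | _ = ⊥-elim (¬D Dp)

  overwrite-on : ∀ D y a p → ¬ D p → a p → overwrite D y a p ≡ on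
  overwrite-on D y a p ¬Dp ap with em (D p) | em (a p)
  ... | yes Dp | _      = ⊥-elim (¬Dp Dp)
  ... | no _   | yes _  = refl
  ... | no _   | no ¬ap = ⊥-elim (¬ap ap)

  overwrite-off : ∀ D y a p → ¬ D p → ¬ a p → overwrite D y a p ≡ off
  overwrite-off D y a p ¬Dp ¬ap with em (D p) | em (a p)
  ... | yes Dp | _      = ⊥-elim (¬Dp Dp)
  ... | no _   | yes ap = ⊥-elim (¬ap ap)
  ... | no _   | no _   = refl

  overwrite-cases : ∀ D y a p → overwrite D y a p ≡ on → (D p × y p ≡ on) ⊎ (¬ D p × a p)
  overwrite-cases D y a p eq with em (D p) | em (a p)
  ... | yes Dp | _      = inj₁ (Dp , eq)
  ... | no ¬Dp | yes ap = inj₂ (¬Dp , ap)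
  ... | no _   | no _   = ⊥-elim (on≢off (sym eq))

  record Splitting : Set₁ where
    field
      part     : K → Pred K 0ℓ
      positive : ∀ k → part k ∉ 𝓘
      disjoint : ∀ {j k p} → part j p → part k p → j ≡ k

  -- A mark is a single coordinate with value `on`, so at a limit it was already decided at some
  -- stage. Positivity of `part k` provides a fresh coordinate outside any set in `𝓘`.
  splitting⇒marks : Splitting → Marks
  splitting⇒marks S = record
    { early       = λ _ → ∅
    ; early-small = λ _ → empty
    ; Good        = λ _ → ⊤
    ; Mark        = λ k x → ∃ λ p → part k p × x p ≡ on
    ; Sealed      = λ _ _ _ → Lift _ ⊤
    ; mark-local  = λ k x (p , kp , xp) → (_≡ p) , singleton-small p , λ y x≈y → p , kp , ≡.trans (sym (x≈y p refl)) xp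
    ; set-mark    = λ y _ D small k →
        let (p , kp , ¬Dp) = by-contra {A = ∃ λ p → part k p × ¬ D p} λ none →
              positive k (downward (λ {p} kp → by-contra λ ¬Dp → none (p , kp , ¬Dp)) small)
            x = overwrite D y (_≡ p)
        in x , D ∪ (_≡ p) , inj₁ , ∪-small small (singleton-small p) , overwrite-agree D y _ ,
           (λ q out → overwrite-off D y _ q (out ∘ inj₁) (out ∘ inj₂)) , tt , lift tt ,
           (λ z x≈z → p , kp , ≡.trans (sym (x≈z p (inj₂ refl))) (overwrite-on D y _ p ¬Dp refl)) ,
           λ j (q , jq , xq) → case overwrite-cases D y _ q xq of λ where
             (inj₁ (_ , yq))   → inj₂ (q , jq , yq)
             (inj₂ (_ , refl)) → inj₁ (disjoint jq kp)
    ; limit       = λ J _ h coherent x agree offs → tt , λ k (p , kp , xp) →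
        let (t , Jt , Dtp) = by-contra {A = ∃ λ t → J t × Stage.domain (h t) p} λ none →
              on≢off (≡.trans (sym xp) (offs p λ t Jt Dtp → none (t , Jt , Dtp)))
        in t , Jt , λ u Ju t≤u → p , kp , ≡.trans (agree u Ju p (grow coherent Ju t≤u Dtp)) xp
    }
    where
    open Splitting S
    grow : ∀ {J : Pred K 0ℓ} {h : K → Stage} {early sealed} → (∀ t → J t → Coherent early sealed t (λ u _ → h u) (h t)) →
           ∀ {t u} → J u → t ≤ u → Stage.domain (h t) ⊆ Stage.domain (h u)
    grow coherent Ju t≤u Dtp with ≤⇒<⊎≡ t≤u
    ... | inj₁ t<u  = Coherent.later (coherent _ Ju) _ t<u Dtp
    ... | inj₂ refl = Dtp

-- Minimal unbounded functions and normality in the absence of a splitting.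

module Saturated (cl : Classical) (κ : WellOrder) (uncountableRegular : IsUncountableRegular κ)
                 (𝓘 : Family (Carrier κ)) (ideal : IsCompleteProperIdeal κ 𝓘) (containsBounded : ContainsBounded κ 𝓘)
                 (ν : Base) where
  open Space cl κ uncountableRegular 𝓘 ideal containsBounded ν
  open DisjointPositive cl κ uncountableRegular 𝓘 ideal containsBounded ν using (Splitting)

  Unbounded : Pred K 0ℓ → (K → K) → Set₁
  Unbounded N r = ∀ i → (λ p → N p × r p < i) ∈ 𝓘

  -- `π` takes the place of the identity in Fodor's lemma: a function below it on a positive subset
  -- of `N` is bounded on a positive set.
  record MinimalFunction : Set₁ where
    field
      N         : Pred K 0ℓ
      π         : K → K
      positive  : N ∉ 𝓘
      unbounded-π : Unbounded N π
      minimality  : ∀ M r → (∀ p → M p → N p) → M ∉ 𝓘 → (∀ p → M p → r p < π p) → ¬ Unbounded M r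

  module _ (¬splitting : ¬ Splitting) where

    private
      Smaller : Pred K 0ℓ → (K → K) → Pred K 0ℓ → (K → K) → Set₁
      Smaller N r M s = (∀ p → M p → N p) × M ∉ 𝓘 × Unbounded M s × (∀ p → M p → s p < r p)

      -- If every function can be decreased on a positive set, then a maximal
      -- disjoint family of such decreases has fewer than κ members, so they
      -- can be glued to a decrease almost everywhere.

      module _ (decrease : ∀ N r → N ∉ 𝓘 → Unbounded N r → ∃₂ (Smaller N r)) where

        module _ (r : K → K) (unb : Unbounded U r) where

          Rest : ∀ i → (∀ u → u < i → Pred K 0ℓ × (K → K)) → Pred K 0ℓ
          Rest i prev p = ¬ (∃ λ u → ∃ λ u<i → proj₁ (prev u u<i) p)

          Piece : ∀ i → (∀ u → u < i → Pred K 0ℓ × (K → K)) → Pred K 0ℓ × (K → K) → Set₁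
          Piece i prev (M , s) = (Rest i prev ∉ 𝓘 → Smaller (Rest i prev) r M s) × (Rest i prev ∈ 𝓘 → ∀ p → ¬ M p)

          pieces : ∃ λ h → ∀ i → Piece i (λ u _ → h u) (h i)
          pieces = recursive-choice wellFounded Piece (∅ , id) λ i h → total i h
            where
            total : ∀ i h → ∃ (Piece i (λ u _ → h u))
            total i h with em (Rest i (λ u _ → h u) ∈ 𝓘)
            ... | yes small = (∅ , id) , (λ big → ⊥-elim (big small)) , λ _ _ ()
            ... | no big    =
              let (M , s , smaller) = decrease _ r big (λ j → downward (λ (_ , r<) → tt , r<) (unb j)) in
              (M , s) , (λ _ → smaller) , λ small → ⊥-elim (big small)

          M : K → Pred K 0ℓ
          M i = proj₁ (proj₁ pieces i)

          s : K → K → K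
          s i = proj₂ (proj₁ pieces i)

          -- Otherwise all pieces are positive and disjoint from the earlier ones, which is a
          -- splitting.
          exhausted : ∃ λ i → Rest i (λ u _ → proj₁ pieces u) ∈ 𝓘
          exhausted = by-contra λ none →
            let smaller : ∀ i → Smaller (Rest i (λ u _ → proj₁ pieces u)) r (M i) (s i)
                smaller i = proj₁ (proj₂ pieces i) (λ small → none (i , small))
            in ¬splitting record
              { part     = M
              ; positive = λ k → proj₁ (proj₂ (smaller k))
              ; disjoint = λ {j} {k} Mj Mk → case compare j k of λ where
                  (tri< j<k _ _) → ⊥-elim (proj₁ (smaller k) _ Mk (j , j<k , Mj))
                  (tri≈ _ j≡k _) → j≡k
                  (tri> _ _ k<j) → ⊥-elim (proj₁ (smaller j) _ Mj (k , k<j , Mk))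
              }

          unbounded-piece : ∀ i → Unbounded (M i) (s i)
          unbounded-piece i β with em (Rest i (λ u _ → proj₁ pieces u) ∈ 𝓘)
          ... | yes small = downward (λ (Mp , _) → ⊥-elim (proj₂ (proj₂ pieces i) small _ Mp)) empty
          ... | no big    = proj₁ (proj₂ (proj₂ (proj₁ (proj₂ pieces i) big))) β

          decreasing-piece : ∀ i p → M i p → s i p < r p
          decreasing-piece i p Mp with em (Rest i (λ u _ → proj₁ pieces u) ∈ 𝓘)
          ... | yes small = ⊥-elim (proj₂ (proj₂ pieces i) small p Mp)
          ... | no big    = proj₂ (proj₂ (proj₂ (proj₁ (proj₂ pieces i) big))) p Mp

          glued : K → K
          glued p with em (∃ λ u → u < proj₁ exhausted × M u p)
          ... | yes (u , _) = s u p
          ... | no _        = r p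

          glued-unbounded : Unbounded U glued
          glued-unbounded β = downward cover (∪-small (proj₂ exhausted)
            (⋃<-small {proj₁ exhausted} (λ u p → M u p × s u p < β) λ u _ → unbounded-piece u β))
            where
            cover : (λ p → U p × glued p < β) ⊆ (Rest (proj₁ exhausted) (λ u _ → proj₁ pieces u)) ∪ (λ p → ∃ λ u → u < proj₁ exhausted × M u p × s u p < β)
            cover {p} (_ , g<β) with em (∃ λ u → u < proj₁ exhausted × M u p)
            ... | yes (u , u<i , Mup) = inj₂ (u , u<i , Mup , g<β)
            ... | no none             = inj₁ λ (u , u<i , Mup) → none (u , u<i , Mup)

          glued-decreasing : (λ p → ¬ (glued p < r p)) ∈ 𝓘
          glued-decreasing = downward cover (proj₂ exhausted)
            where
            cover : (λ p → ¬ (glued p < r p)) ⊆ Rest (proj₁ exhausted) (λ u _ → proj₁ pieces u)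
            cover {p} ≮ (u , u<i , Mup) with em (∃ λ u → u < proj₁ exhausted × M u p)
            ... | yes (v , _ , Mvp) = ≮ (decreasing-piece v p Mvp)
            ... | no none           = none (u , u<i , Mup)

        descent : ℕ → Σ (K → K) (Unbounded U)
        descent zero    = id , λ i → containsBounded _ (i , proj₂)
        descent (suc n) = let (r , unb) = descent n in glued r unb , glued-unbounded r unb

        -- Countable completeness leaves a point `p` at which every step of the descent is strict,
        -- giving an infinite decreasing sequence in `κ`.
        no-descent : ⊥
        no-descent =
          let small : ⋃ ℕ (λ n p → ¬ (proj₁ (descent (suc n)) p < proj₁ (descent n) p)) ∈ 𝓘
              small = ⋃ℕ-small _ λ n → glued-decreasing (proj₁ (descent n)) (proj₂ (descent n))
              (p , p∉) = by-contra {A = ∃ λ p → ¬ (∃ λ n → ¬ (proj₁ (descent (suc n)) p < proj₁ (descent n) p))} λ none →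
                proper (downward (λ {p} _ → by-contra λ p∉ → none (p , p∉)) small)
              (_ , (n , eq) , min) = least (λ α → ∃ λ n → proj₁ (descent n) p ≡ α) (_ , 0 , refl)
          in p∉ (n , λ lt → min (proj₁ (descent (suc n)) p) (subst (proj₁ (descent (suc n)) p <_) eq lt) (suc n , refl))

    minimal-function : MinimalFunction
    minimal-function = by-contra λ none → no-descent λ N r positive unb → by-contra λ ¬smaller →
      none record { N = N ; π = r ; positive = positive ; unbounded-π = unb
                  ; minimality = λ M s M⊆N big below unb′ → ¬smaller (M , s , M⊆N , big , unb′ , below) }

  module Normal (minimal : MinimalFunction) where
    open MinimalFunction minimal public

    pressing-down : ∀ M r → (∀ p → M p → N p) → M ∉ 𝓘 → (∀ p → M p → r p < π p) → ∃ λ β → (λ p → M p × r p < β) ∉ 𝓘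
    pressing-down M r M⊆N big below = ¬∀⇒∃¬ (minimality M r M⊆N big below)

    ∇ : (K → Pred K 0ℓ) → Pred K 0ℓ
    ∇ D p = N p × ∃ λ i → i < π p × D i p

    -- If `∇ D` were positive, the chosen index, being below `π`, would be bounded on a positive
    -- set; but that set is covered by fewer than `κ` members of `𝓘`.
    ∇-small : ∀ D → (∀ i → D i ∈ 𝓘) → ∇ D ∈ 𝓘
    ∇-small D small = by-contra λ big →
      let (β , big′) = pressing-down (∇ D) index (λ _ → proj₁) big (λ p ∇p → proj₁ (index-holds p ∇p)) in
      big′ (downward (λ {p} (∇p , i<β) → index p , i<β , proj₂ (index-holds p ∇p)) (⋃<-small D λ u _ → small u))
      where
      index : K → K
      index p = select (λ i → i < π p × D i p) p
      index-holds : ∀ p → ∇ D p → index p < π p × D (index p) p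
      index-holds p (_ , ∃i) = select-holds (λ i → i < π p × D i p) p ∃i

    -- The nonstationary ideal, pulled back along π: the least normal ideal.

    Thin : Pred (Pred K 0ℓ) 0ℓ
    Thin E = ∃ λ g → ∀ p → N p → E p → ¬ Closed g (π p)

    thin-⊆ : ∀ {E F} → (∀ p → N p → E p → F p) → Thin F → Thin E
    thin-⊆ E⊆F (g , avoid) = g , λ p Np Ep → avoid p Np (E⊆F p Np Ep)

    thin-∪ : ∀ {E F} → Thin E → Thin F → Thin (E ∪ F)
    thin-∪ (g , avoid) (h , avoid′) = (λ δ → max (g δ) (h δ)) , λ p Np EFp closed → case EFp of λ where
      (inj₁ Ep) → avoid p Np Ep (closed-≤ (λ δ → max-≤ˡ _ _) closed)
      (inj₂ Fp) → avoid′ p Np Fp (closed-≤ (λ δ → max-≤ʳ _ _) closed)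

    thin-∇ : ∀ E → (∀ i → Thin (E i)) → Thin (∇ E)
    thin-∇ E thin = let (h , h>) = hull₂ (λ i → proj₁ (thin i)) in
      h , λ p Np (_ , i , i<π , Ep) (pos , closed) → proj₂ (thin i) p Np Ep (pos , λ δ δ<π →
        <-trans (h> i δ (max i δ) (max-≤ˡ i δ) (max-≤ʳ i δ)) (closed _ (max-< i<π δ<π)))

    thin-bounded : ∀ i → Thin (λ p → π p ≤ i)
    thin-bounded i = (λ _ → i) , λ p _ π≤i ((δ , δ<π) , closed) → π≤i (closed δ δ<π)

    thin-⋃ℕ : (E : ℕ → Pred K 0ℓ) → (∀ n → Thin (E n)) → Thin (⋃ ℕ E)
    thin-⋃ℕ E thin = thin-⊆ cover (thin-∪ (thin-bounded (proj₁ omega)) (thin-∇ (spread ∅ E) spread-thin))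
      where
      spread-thin : ∀ i → Thin (spread ∅ E i)
      spread-thin i with em (∃ λ n → nat n ≡ i)
      ... | yes (n , _) = thin n
      ... | no _        = id , λ _ _ ()
      cover : ∀ p → N p → ⋃ ℕ E p → ((λ p → π p ≤ proj₁ omega) ∪ ∇ (spread ∅ E)) p
      cover p Np (n , Ep) with <⊎≥ (proj₁ omega) (π p)
      ... | inj₁ ω<π = inj₂ (Np , nat n , <-trans (proj₂ omega n) ω<π , subst (λ F → F p) (sym (spread-nat ∅ E n)) Ep)
      ... | inj₂ π≤ω = inj₁ π≤ω

    -- Where `π p` is positive and not closed under `g`, some `δ < π p` has `π p ≤ g δ`. Pressing
    -- down bounds `δ` on a positive set, hence `g δ` and `π p`, against `unbounded-π`.
    thin⇒small : ∀ {E} → Thin E → N ∩ E ∈ 𝓘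
    thin⇒small {E} (g , avoid) = by-contra λ big →
      let M : Pred K 0ℓ
          M p = (N p × E p) × Positive κ (π p)
          M-big : M ∉ 𝓘
          M-big small = big (downward cover (∪-small small (unbounded-π (nat 1))))
          (β , big′) = pressing-down M index (λ _ ((Np , _) , _) → Np) M-big (λ p Mp → proj₁ (index-holds p Mp))
          (b , g<b) = bounded β g
      in big′ (downward (λ {p} (Mp , i<β) → proj₁ (proj₁ Mp) , ≤-<-trans (proj₂ (index-holds p Mp)) (g<b i<β)) (unbounded-π b))
      where
      index : K → K
      index p = select (λ δ → δ < π p × π p ≤ g δ) p
      index-holds : ∀ p → (N p × E p) × Positive κ (π p) → index p < π p × π p ≤ g (index p)
      index-holds p ((Np , Ep) , pos) = select-holds (λ δ → δ < π p × π p ≤ g δ) p (by-contra λ none →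
        avoid p Np Ep (pos , λ δ δ<π → by-contra λ ≮ → none (δ , δ<π , ≮)))
      cover : N ∩ E ⊆ (λ p → (N p × E p) × Positive κ (π p)) ∪ (λ p → N p × π p < nat 1)
      cover {p} (Np , Ep) with <⊎≥ (π p) (nat 1)
      ... | inj₁ π<1 = inj₂ (Np , π<1)
      ... | inj₂ 1≤π = inj₁ ((Np , Ep) , nat 0 , <-≤-trans (nat-< {0} {1} (ℕ.s≤s ℕ.z≤n)) 1≤π)

-- Zermelo's well-ordering theorem.

module Zermelo (cl : Classical) (A : Set) where
  open Choice cl
  open Classical cl using (extensionality)

  private
    code : Pred A 0ℓ → A → Bool
    code S a = does (em (S a))

    code-cong : ∀ {S R} → (∀ a → S a → R a) → (∀ a → R a → S a) → code S ≡ code R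
    code-cong {S} {R} S⊆R R⊆S = extensionality eq
      where
      eq : ∀ a → code S a ≡ code R a
      eq a with em (S a) | em (R a)
      ... | yes _  | yes _  = refl
      ... | yes Sa | no ¬Ra = ⊥-elim (¬Ra (S⊆R a Sa))
      ... | no ¬Sa | yes Ra = ⊥-elim (¬Sa (R⊆S a Ra))
      ... | no _   | no _   = refl

    code-sound : ∀ (S : Pred A 0ℓ) {a} → T (code S a) → S a
    code-sound S {a} t with em (S a)
    code-sound S {a} t  | yes Sa = Sa
    code-sound S {a} () | no _

    code-complete : ∀ (S : Pred A 0ℓ) {a} → S a → T (code S a)
    code-complete S {a} Sa with em (S a)
    ... | yes _  = tt
    ... | no ¬Sa = ⊥-elim (¬Sa Sa)

    -- The choice depends on S only up to extensional equality.

    chosen′ : (A → Bool) → Pred A 0ℓ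
    chosen′ c a with em (∃ λ b → ¬ T (c b))
    ... | yes (b , _) = a ≡ b
    ... | no _        = ⊥

    chosen : Pred A 0ℓ → Pred A 0ℓ
    chosen S = chosen′ (code S)

    chosen-unique : ∀ S {a b} → chosen S a → chosen S b → a ≡ b
    chosen-unique S a∈ b∈ with em (∃ λ b → ¬ T (code S b))
    ... | yes _ = ≡.trans a∈ (sym b∈)
    ... | no _  = ⊥-elim a∈

    chosen-∉ : ∀ {S a} → chosen S a → ¬ S a
    chosen-∉ {S} a∈ with em (∃ λ b → ¬ T (code S b))
    ... | yes (b , b∉) = λ Sa → b∉ (subst (λ b → T (code S b)) a∈ (code-complete S Sa))
    ... | no _         = ⊥-elim a∈

    chosen-exists : ∀ {S a} → ¬ S a → ∃ (chosen S)
    chosen-exists {S} {a} ¬Sa with em (∃ λ b → ¬ T (code S b))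
    ... | yes (b , _) = b , refl
    ... | no none     = ⊥-elim (none (a , λ t → ¬Sa (code-sound S t)))

    grow : Pred A 0ℓ → Pred A 0ℓ
    grow S = S ∪ chosen S

    _⊑_ : Pred A 0ℓ → Pred A 0ℓ → Set
    S ⊑ R = ∀ a → S a → R a

    -- These sets turn out to be initial segments of the order; the empty union starts the tower.
    data Tower : Pred A 0ℓ → Set₁ where
      next : ∀ {S} → Tower S → Tower (grow S)
      lim  : (J : Set) (S : J → Pred A 0ℓ) → (∀ j → Tower (S j)) → Tower (⋃ J S)
      same : ∀ {S R} → S ⊑ R → R ⊑ S → Tower S → Tower R

    module _ {S} (comparable : ∀ {R} → Tower R → R ⊑ S ⊎ S ⊑ R) where

      -- Nothing fits strictly between `R` and `grow R`, which differ by at most one element. So if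
      -- `R ⊑ S ⊑ grow R`, either `grow R ⊑ S`, or `R` and `S` are extensionally equal and choose
      -- the same element.
      grow-compare : ∀ {R} → Tower R → R ⊑ S ⊎ grow S ⊑ R
      grow-compare (same R⊑R′ R′⊑R t) with grow-compare t
      ... | inj₁ R⊑S = inj₁ λ a → R⊑S a ∘ R′⊑R a
      ... | inj₂ S⊑R = inj₂ λ a → R⊑R′ a ∘ S⊑R a
      grow-compare (lim J R t) with em (∃ λ j → grow S ⊑ R j)
      ... | yes (j , S⊑R) = inj₂ λ a Sa → j , S⊑R a Sa
      ... | no none = inj₁ λ a (j , Ra) → case grow-compare (t j) of λ where
        (inj₁ R⊑S) → R⊑S a Ra
        (inj₂ S⊑R) → ⊥-elim (none (j , S⊑R))
      grow-compare (next {R} t) with grow-compare t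
      ... | inj₂ S⊑R = inj₂ λ a Sa → inj₁ (S⊑R a Sa)
      ... | inj₁ R⊑S with comparable (next t)
      ...   | inj₁ gR⊑S = inj₁ gR⊑S
      ...   | inj₂ S⊑gR with em (∃ λ a → chosen R a × S a)
      ...     | yes (a , Ra , Sa) = inj₁ λ b → [ R⊑S b , (λ Rb → subst S (chosen-unique R Ra Rb) Sa) ]′
      ...     | no none = inj₂ λ a → [ (λ Sa → inj₁ (S⊑R a Sa)) , (λ Sa → inj₂ (subst (λ c → chosen′ c a) (code-cong S⊑R R⊑S) Sa)) ]′
        where
        S⊑R : S ⊑ R
        S⊑R a Sa with S⊑gR a Sa
        ... | inj₁ Ra = Ra
        ... | inj₂ Ra = ⊥-elim (none (a , Ra , Sa))

    tower-compare : ∀ {S} → Tower S → ∀ {R} → Tower R → R ⊑ S ⊎ S ⊑ R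
    tower-compare (next t) u with grow-compare (tower-compare t) u
    ... | inj₁ R⊑S = inj₁ λ a Ra → inj₁ (R⊑S a Ra)
    ... | inj₂ S⊑R = inj₂ S⊑R
    tower-compare (lim J S t) {R} u with em (∃ λ j → R ⊑ S j)
    ... | yes (j , R⊑S) = inj₁ λ a Ra → j , R⊑S a Ra
    ... | no none = inj₂ λ a (j , Sa) → case tower-compare (t j) u of λ where
      (inj₁ R⊑S) → ⊥-elim (none (j , R⊑S))
      (inj₂ S⊑R) → S⊑R a Sa
    tower-compare (same S⊑S′ S′⊑S t) u with tower-compare t u
    ... | inj₁ R⊑S = inj₁ λ a → S⊑S′ a ∘ R⊑S a
    ... | inj₂ S⊑R = inj₂ λ a → S⊑R a ∘ S′⊑S a

    Less : A → A → Set₁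
    Less a b = ∃ λ S → Tower S × S a × ¬ S b

    _<_ : Rel A 0ℓ
    a < b = ⌊ Less a b ⌋

    -- The largest tower set that omits `a`. Boolean codes keep the index type of the union in
    -- `Set`.
    below : A → Pred A 0ℓ
    below a = ⋃ (∃ λ (c : A → Bool) → ⌊ Tower (T ∘ c) ⌋ × ¬ T (c a)) (λ (c , _) → T ∘ c)

    below-tower : ∀ a → Tower (below a)
    below-tower a = lim _ _ λ (_ , t , _) → unwrap t

    below-∉ : ∀ a → ¬ below a a
    below-∉ a ((_ , _ , a∉) , a∈) = a∉ a∈

    below-largest : ∀ {S a} → Tower S → ¬ S a → S ⊑ below a
    below-largest {S} t ¬Sa b Sb =
      (code S , wrap (same (λ _ → code-complete S) (λ _ → code-sound S) t) , ¬Sa ∘ code-sound S) , code-complete S Sb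

    -- Otherwise `grow (below a)` still omits `a`, and maximality of `below a` puts the chosen
    -- element into `below a` itself.
    chosen-below : ∀ a → chosen (below a) a
    chosen-below a = by-contra λ a∉ → let (b , b∈) = chosen-exists {below a} (below-∉ a) in
      chosen-∉ {below a} b∈ (below-largest (next (below-tower a)) [ below-∉ a , a∉ ]′ b (inj₂ b∈))

    less-asym : ∀ {a b} → Less a b → ¬ Less b a
    less-asym (S , t , Sa , ¬Sb) (R , u , Rb , ¬Ra) with tower-compare t u
    ... | inj₁ R⊑S = ¬Sb (R⊑S _ Rb)
    ... | inj₂ S⊑R = ¬Ra (S⊑R _ Sa)

    less-trans : ∀ {a b c} → Less a b → Less b c → Less a c
    less-trans (S , t , Sa , ¬Sb) (R , u , Rb , ¬Rc) with tower-compare t u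
    ... | inj₁ R⊑S = ⊥-elim (¬Sb (R⊑S _ Rb))
    ... | inj₂ S⊑R = R , u , S⊑R _ Sa , ¬Rc

    less-connex : ∀ a b → Less a b ⊎ a ≡ b ⊎ Less b a
    less-connex a b with em (below a b) | em (a ≡ b)
    ... | yes b∈ | _        = inj₂ (inj₂ (below a , below-tower a , b∈ , below-∉ a))
    ... | no _   | yes a≡b  = inj₂ (inj₁ a≡b)
    ... | no b∉  | no a≢b   = inj₁ (grow (below a) , next (below-tower a) , inj₂ (chosen-below a) ,
      [ b∉ , (λ b∈ → a≢b (chosen-unique (below a) (chosen-below a) b∈)) ]′)

    tower-accessible : ∀ {S} → Tower S → ∀ a → S a → Acc _<_ a
    tower-accessible (lim J S t) a (j , Sa)     = tower-accessible (t j) a Sa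
    tower-accessible (same _ R⊑S t) a Ra        = tower-accessible t a (R⊑S a Ra)
    tower-accessible (next t) a (inj₁ Sa)       = tower-accessible t a Sa
    tower-accessible (next {S} t) a (inj₂ a∈) = acc λ {b} b<a →
      let (R , u , Rb , ¬Ra) = unwrap b<a in
      case grow-compare (tower-compare t) u of λ where
        (inj₁ R⊑S) → tower-accessible t b (R⊑S b Rb)
        (inj₂ S⊑R) → ⊥-elim (¬Ra (S⊑R a (inj₂ a∈)))

    abstract
      isStrictTotalOrder : IsStrictTotalOrder _≡_ _<_
      isStrictTotalOrder = record
        { isStrictPartialOrder = record
          { isEquivalence = ≡.isEquivalence
          ; irrefl        = λ { refl a<a → less-asym (unwrap a<a) (unwrap a<a) }
          ; trans         = λ a<b b<c → wrap (less-trans (unwrap a<b) (unwrap b<c))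
          ; <-resp-≈      = ≡.resp₂ _<_
          }
        ; compare = compare
        }
        where
        compare : ∀ a b → Tri (a < b) (a ≡ b) (b < a)
        compare a b with less-connex a b
        ... | inj₁ lt          = tri< (wrap lt) (λ { refl → less-asym lt lt }) (λ gt → less-asym lt (unwrap gt))
        ... | inj₂ (inj₁ refl) = tri≈ (λ lt → less-asym (unwrap lt) (unwrap lt)) refl (λ gt → less-asym (unwrap gt) (unwrap gt))
        ... | inj₂ (inj₂ gt)   = tri> (λ lt → less-asym (unwrap lt) gt) (λ { refl → less-asym gt gt }) (wrap gt)

    abstract
      wellFounded : WellFounded _<_
      wellFounded a = tower-accessible (next (below-tower a)) a (inj₂ (chosen-below a))

  well-order : WellOrder
  well-order = record
    { Carrier            = A
    ; _<_                = _<_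
    ; isStrictTotalOrder = isStrictTotalOrder
    ; wellFounded        = wellFounded
    }

-- A shortest family in `𝓘` that is unbounded modulo thin sets, and its length `Θ`.

module Subtype (cl : Classical) (W : WellOrder) (P : Pred (Carrier W) 0ℓ) where
  open Choice cl
  open Order cl W

  sub-well-order : WellOrder
  sub-well-order = record
    { Carrier            = Σ (Carrier W) λ x → ⌊ P x ⌋
    ; _<_                = λ x y → proj₁ x < proj₁ y
    ; isStrictTotalOrder = record
      { isStrictPartialOrder = record
        { isEquivalence = ≡.isEquivalence
        ; irrefl        = λ { refl → <-irrefl }
        ; trans         = <-trans
        ; <-resp-≈      = ≡.resp₂ _
        }
      ; compare = λ x y → case compare (proj₁ x) (proj₁ y) of λ where
          (tri< lt ≢ ≯) → tri< lt (≢ ∘ cong proj₁) ≯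
          (tri≈ ≮ ≡ ≯)  → tri≈ ≮ (Σ⌊⌋-≡ ≡) ≯
          (tri> ≮ ≢ gt) → tri> ≮ (≢ ∘ cong proj₁) gt
      }
    ; wellFounded = On.wellFounded proj₁ wellFounded
    }

module LongOrder (cl : Classical) (κ : WellOrder) (uncountableRegular : IsUncountableRegular κ)
                 (𝓘 : Family (Carrier κ)) (ideal : IsCompleteProperIdeal κ 𝓘) (containsBounded : ContainsBounded κ 𝓘)
                 (ν : Base) where
  open Space cl κ uncountableRegular 𝓘 ideal containsBounded ν
  open DisjointPositive cl κ uncountableRegular 𝓘 ideal containsBounded ν using (Splitting)
  open Saturated cl κ uncountableRegular 𝓘 ideal containsBounded ν

  module Construction (¬splitting : ¬ Splitting) (minimal : MinimalFunction) where
    open Normal minimal public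

    infix 4 _⋐_

    _⋐_ : Rel (Pred K 0ℓ) 0ℓ
    E ⋐ D = Thin (λ p → E p × ¬ D p)

    ⊆⇒⋐ : ∀ {E D} → (∀ p → E p → D p) → E ⋐ D
    ⊆⇒⋐ E⊆D = id , λ p _ (Ep , ¬Dp) → ⊥-elim (¬Dp (E⊆D p Ep))

    ⋐-trans : ∀ {E F G} → E ⋐ F → F ⋐ G → E ⋐ G
    ⋐-trans {E} {F} {G} E⋐F F⋐G = thin-⊆ cover (thin-∪ E⋐F F⋐G)
      where
      cover : ∀ p → N p → E p × ¬ G p → ((λ p → E p × ¬ F p) ∪ (λ p → F p × ¬ G p)) p
      cover p _ (Ep , ¬Gp) with em (F p)
      ... | yes Fp = inj₂ (Fp , ¬Gp)
      ... | no ¬Fp = inj₁ (Ep , ¬Fp)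

    -- Otherwise 𝓘 would be nonstationary-like below N ∖ D, and Solovay's
    -- theorem would split it.

    abstract
      no-bound : ¬ (∃ λ D → D ∈ 𝓘 × (∀ E → E ∈ 𝓘 → E ⋐ D))
      no-bound (D , D-small , bound) =
        let (T′ , stat , T′⊆S , disjoint) = StationaryParts.stationary-parts cl κ κ regularity bounded S-stationary
        in ¬splitting record
          { part     = λ k p → M p × T′ k (π p)
          ; positive = λ k small →
              let (h , avoid) = bound _ small
                  (α , T′α , closed) = stat k h
                  (p , Mp@(Np , ¬Dp) , πp≡α) = T′⊆S k α T′α
              in avoid p Np ((Mp , subst (T′ k) (sym πp≡α) T′α) , ¬Dp) (subst (Closed h) (sym πp≡α) closed)
          ; disjoint = λ {j} {k} {p} (_ , Tj) (_ , Tk) → disjoint j k (π p) Tj Tk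
          }
        where
        M : Pred K 0ℓ
        M p = N p × ¬ D p
        S : Pred K 0ℓ
        S α = ∃ λ p → M p × π p ≡ α
        S-stationary : Stationary S
        S-stationary h = by-contra λ none → positive
          (downward (λ {p} Np → case em (D p) of λ where
              (yes Dp) → inj₂ Dp
              (no ¬Dp) → inj₁ (Np , Np , ¬Dp))
            (∪-small (thin⇒small {E = M} (h , λ p Np Mp closed → none (π p , (p , Mp , refl) , closed))) D-small))

    private
      Code : Set
      Code = Σ (K → Bool) λ c → ⌊ (T ∘ c) ∈ 𝓘 ⌋

      El : Code → Pred K 0ℓ
      El (c , _) = T ∘ c

      El-small : ∀ c → El c ∈ 𝓘
      El-small (_ , small) = unwrap small

      encode : ∀ D → D ∈ 𝓘 → ∃ λ c → (∀ p → El c p → D p) × (∀ p → D p → El c p)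
      encode D small = ((λ p → isYes (em (D p))) , wrap (downward (λ {p} → toWitness) small)) ,
                       (λ p → toWitness) , (λ p → fromWitness)

      codes : WellOrder
      codes = Zermelo.well-order cl Code

      module W = Order cl codes

      Unbounded< : Pred Code 0ℓ
      Unbounded< α = ∃ λ (E : Code → Code) → ¬ (∃ λ c → ∀ β → β W.< α → El (E β) ⋐ El c)

      -- The codes below the least length of an unbounded family, or all codes if no code is such a
      -- length.
      Short : Pred Code 0ℓ
      Short β = ¬ (∃ λ α → α W.≤ β × Unbounded< α)

      Raw : Set
      Raw = Σ Code λ β → ⌊ Short β ⌋

      abstract
        -- If no code is the length of an unbounded family, all codes are short and the identity
        -- enumerates the whole of `𝓘`, which has no bound by `no-bound`.
        unbounded-family : ∃ λ (E : Code → Code) → ¬ (∃ λ c → ∀ β → Short β → El (E β) ⋐ El c)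
        unbounded-family with em (∃ Unbounded<)
        ... | yes ∃α = let (α , (E , unb) , min) = W.least Unbounded< ∃α in
          E , λ (c , bound) → unb (c , λ β β<α → bound β λ (γ , γ≤β , unbγ) → min γ (W.≤-<-trans γ≤β β<α) unbγ)
        ... | no none = id , λ (c , bound) → no-bound (El c , El-small c , λ D small →
          let (d , d⊆D , D⊆d) = encode D small in
          ⋐-trans (⊆⇒⋐ D⊆d) (bound d λ (γ , _ , unbγ) → none (γ , unbγ)))

      raw-bound : ∀ (ξ : Raw) (F : Raw → Pred K 0ℓ) → (∀ η → F η ∈ 𝓘) →
                  ∃ λ D → D ∈ 𝓘 × (∀ η → proj₁ η W.< proj₁ ξ → F η ⋐ D)
      raw-bound (α , short) F small =
        let (c , bound) = by-contra λ unb → unwrap short (α , W.≤-refl , total , unb) in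
        El c , El-small c , λ η η<ξ → ⋐-trans (total-⊇ η) (bound (proj₁ η) η<ξ)
        where
        total : Code → Code
        total β with em (Short β)
        ... | yes s = proj₁ (encode (F (β , wrap s)) (small _))
        ... | no _  = β
        total-⊇ : ∀ η → F η ⋐ El (total (proj₁ η))
        total-⊇ (β , s) with em (Short β)
        ... | no ¬s  = ⊥-elim (¬s (unwrap s))
        ... | yes s′ = ⊆⇒⋐ λ p Fp → proj₂ (proj₂ (encode (F (β , wrap s′)) (small _))) p
                         (subst (λ s → F (β , s) p) (⌊⌋-irrelevant s (wrap s′)) Fp)

    abstract
      Θ : WellOrder
      Θ = Subtype.sub-well-order cl codes Short

      E : Carrier Θ → Pred K 0ℓ
      E (β , _) = El (proj₁ unbounded-family β)

      E-small : ∀ ξ → E ξ ∈ 𝓘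
      E-small (β , _) = El-small (proj₁ unbounded-family β)

      E-unbounded : ∀ D → D ∈ 𝓘 → ¬ (∀ ξ → E ξ ⋐ D)
      E-unbounded D small bound = let (c , c⊆D , D⊆c) = encode D small in
        proj₂ unbounded-family (c , λ β short → ⋐-trans (bound (β , wrap short)) (⊆⇒⋐ D⊆c))

      segment-bound : ∀ ξ (F : Carrier Θ → Pred K 0ℓ) → (∀ η → F η ∈ 𝓘) →
                      ∃ λ D → D ∈ 𝓘 × (∀ η → WellOrder._<_ Θ η ξ → F η ⋐ D)
      segment-bound = raw-bound

-- Ranks of a point and their limit points in `Θ`.

module LongMarks (cl : Classical) (κ : WellOrder) (uncountableRegular : IsUncountableRegular κ)
                 (𝓘 : Family (Carrier κ)) (ideal : IsCompleteProperIdeal κ 𝓘) (containsBounded : ContainsBounded κ 𝓘)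
                 (ν : Base)
                 (¬splitting : ¬ DisjointPositive.Splitting cl κ uncountableRegular 𝓘 ideal containsBounded ν)
                 (minimal : Saturated.MinimalFunction cl κ uncountableRegular 𝓘 ideal containsBounded ν) where
  open Space cl κ uncountableRegular 𝓘 ideal containsBounded ν
  open DisjointPositive cl κ uncountableRegular 𝓘 ideal containsBounded ν
    using (overwrite; overwrite-agree; overwrite-on; overwrite-off; overwrite-cases)
  open LongOrder.Construction cl κ uncountableRegular 𝓘 ideal containsBounded ν ¬splitting minimal

  private
    Ord : Set
    Ord = Carrier Θ

  module O = Order cl Θ
  open O using () renaming (_<_ to _≺_; _≤_ to _≼_)

  abstract
    seal : Ord → Pred K 0ℓ
    seal ξ = proj₁ (segment-bound ξ E E-small)

    seal-small : ∀ ξ → seal ξ ∈ 𝓘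
    seal-small ξ = proj₁ (proj₂ (segment-bound ξ E E-small))

    seal-bound : ∀ {η ξ} → η ≺ ξ → E η ⋐ seal ξ
    seal-bound {η} {ξ} = proj₂ (proj₂ (segment-bound ξ E E-small)) η

  upper : Ord → Pred K 0ℓ
  upper ξ = seal ξ ∪ E ξ

  upper-small : ∀ ξ → upper ξ ∈ 𝓘
  upper-small ξ = ∪-small (seal-small ξ) (E-small ξ)

  upper-bound : ∀ {η ξ} → η ≼ ξ → E η ⋐ upper ξ
  upper-bound η≼ξ with O.≤⇒<⊎≡ η≼ξ
  ... | inj₁ η≺ξ  = ⋐-trans (seal-bound η≺ξ) (⊆⇒⋐ λ _ → inj₁)
  ... | inj₂ refl = ⊆⇒⋐ λ _ → inj₂

  -- By `upper-bound`, a common bound for the sets `upper` at cofinally many indices bounds the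
  -- whole family `E`.
  not-cofinal : ∀ {I : Set} (f : I → Ord) D → D ∈ 𝓘 → (∀ i → upper (f i) ⋐ D) → ¬ (∀ β → ∃ λ i → β ≼ f i)
  not-cofinal f D small bound cofinal = E-unbounded D small λ β →
    let (i , β≼fi) = cofinal β in ⋐-trans (upper-bound β≼fi) (bound i)

  -- The ordinal Θ is regular and of cofinality above κ, since otherwise a
  -- short family would already be unbounded modulo thin sets.

  K-bounded : (f : K → Ord) → ∃ λ β → ∀ i → f i ≺ β
  K-bounded f = by-contra λ none →
    not-cofinal f (∇ (upper ∘ f)) (∇-small (upper ∘ f) λ i → upper-small (f i))
      (λ i → thin-⊆ (λ p Np (up , ¬∇) i<π → ¬∇ (Np , i , i<π , up)) (thin-bounded i))
      λ β → ¬∀⇒∃¬ λ below → none (β , below)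

  Θ-regular : Regular Θ
  Θ-regular = record
    { unbounded = λ α → by-contra λ none → not-cofinal {I = ⊤} (λ _ → α) (upper α) (upper-small α)
        (λ _ → ⊆⇒⋐ λ _ u → u) λ β → tt , λ α≺β → none (β , α≺β)
    ; bounded = λ α f → by-contra λ none →
        let (D , small , bound) = segment-bound α (upper ∘ f) (λ η → upper-small (f η)) in
        not-cofinal {I = ∃ (_≺ α)} (f ∘ proj₁) D small (λ (γ , γ≺α) → bound γ γ≺α) λ β → by-contra λ none′ →
          none (β , λ {γ} γ≺α → by-contra λ ≮ → none′ ((γ , γ≺α) , ≮))
    }

  open Stationarity cl Θ Θ-regular using () renaming
    (Closed to Closedᶿ; Stationary to Stationaryᶿ; stationary-above to stationaryᶿ-above;
     Cofinal to Cofinalᶿ; hull to hullᶿ; unbounded to unboundedᶿ)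

  -- Labels are placed at such points because countably many sets in `𝓘` suffice to make one of them
  -- a limit of ranks.
  CountableCofinality : Pred Ord 0ℓ
  CountableCofinality γ = ∃ λ (c : ℕ → Ord) → (∀ n → c n ≺ γ) × (∀ δ → δ ≺ γ → ∃ λ n → δ ≺ c n)

  some : Ord
  some = by-contra λ none → E-unbounded ∅ empty λ ξ → ⊥-elim (none ξ)

  ℕ-boundedᶿ : (f : ℕ → Ord) → ∃ λ β → ∀ n → f n ≺ β
  ℕ-boundedᶿ f = let (β , below) = K-bounded (spread some f) in
    β , λ n → subst (_≺ β) (spread-nat some f n) (below (nat n))

  countable-cofinality-stationary : Stationaryᶿ CountableCofinality
  countable-cofinality-stationary g =
    let (h , h-mono , g≺h , ≺h) = hullᶿ g
        e : ℕ → Ord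
        e = λ n → fold some h n
        (γ , e≺γ , min) = O.least (λ γ → ∀ n → e n ≺ γ) (ℕ-boundedᶿ e)
        reach : ∀ δ → δ ≺ γ → ∃ λ n → δ ≼ e n
        reach δ δ≺γ = ¬∀⇒∃¬ (min δ δ≺γ)
    in γ , (e , e≺γ , λ δ δ≺γ → let (n , δ≼en) = reach δ δ≺γ in suc n , O.≤-<-trans δ≼en (≺h (e n))) ,
       (some , e≺γ 0) , λ δ δ≺γ → let (n , δ≼en) = reach δ δ≺γ in
         O.<-trans (O.<-≤-trans (g≺h δ) (h-mono δ (e n) δ≼en)) (e≺γ (suc n))

  abstract
    private
      parts : ∃ λ (T : K → Pred Ord 0ℓ) → (∀ k → Stationaryᶿ (T k)) × (∀ k γ → T k γ → CountableCofinality γ) ×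
              (∀ j k γ → T j γ → T k γ → j ≡ k)
      parts = StationaryParts.stationary-parts cl κ Θ Θ-regular
                (λ _ h → let (β , below) = K-bounded h in β , λ {γ} _ → below γ) countable-cofinality-stationary

    Label : K → Pred Ord 0ℓ
    Label = proj₁ parts

    label-stationary : ∀ k → Stationaryᶿ (Label k)
    label-stationary = proj₁ (proj₂ parts)

    label-cofinality : ∀ {k γ} → Label k γ → CountableCofinality γ
    label-cofinality {k} {γ} = proj₁ (proj₂ (proj₂ parts)) k γ

    label-disjoint : ∀ {j k γ} → Label j γ → Label k γ → j ≡ k
    label-disjoint {j} {k} {γ} = proj₂ (proj₂ (proj₂ parts)) j k γ

  Labelled : Pred Ord 0ℓ
  Labelled γ = ∃ λ k → Label k γ

  ones : Space → Pred K 0ℓ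
  ones x p = x p ≡ on

  Pure : Ord → Pred K 0ℓ → Set
  Pure ξ a = (∀ p → a p → E ξ p) × ¬ Thin a × (∀ η → η ≺ ξ → Thin (a ∩ E η))

  pure-⊆ : ∀ {ξ a b} → Pure ξ a → (∀ p → b p → a p) → ¬ Thin b → Pure ξ b
  pure-⊆ (a⊆E , _ , below) b⊆a ¬thin =
    (λ p → a⊆E p ∘ b⊆a p) , ¬thin , λ η η≺ξ → thin-⊆ (λ p _ (bp , Ep) → b⊆a p bp , Ep) (below η η≺ξ)

  pure-unique : ∀ {ξ η a} → Pure ξ a → Pure η a → ξ ≡ η
  pure-unique {ξ} {η} (a⊆ξ , ¬thin , below) (a⊆η , _ , below′) with O.compare ξ η
  ... | tri< ξ≺η _ _ = ⊥-elim (¬thin (thin-⊆ (λ p _ ap → ap , a⊆ξ p ap) (below′ ξ ξ≺η)))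
  ... | tri≈ _ eq _  = eq
  ... | tri> _ _ η≺ξ = ⊥-elim (¬thin (thin-⊆ (λ p _ ap → ap , a⊆η p ap) (below η η≺ξ)))

  -- The least `ξ` with `E ξ` not almost contained in `D′` works: earlier `E ζ` are almost inside
  -- `D′`, so the part of `E ξ` outside `D′` is new. The summand `upper η` forces `η ≺ ξ`.
  pure-outside : ∀ D → D ∈ 𝓘 → ∀ η → ∃ λ ξ → η ≺ ξ × ∃ λ a → Pure ξ a × (∀ p → a p → ¬ D p) × a ∈ 𝓘
  pure-outside D small η =
    let D′ = D ∪ upper η
        (ξ , E⋐̸D , min) = O.least (λ ξ → ¬ (E ξ ⋐ D′)) (¬∀⇒∃¬ (E-unbounded D′ (∪-small small (upper-small η))))
    in ξ , by-contra (λ ξ≼η → E⋐̸D (⋐-trans (upper-bound ξ≼η) (⊆⇒⋐ λ _ → inj₂))) ,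
       (λ p → E ξ p × ¬ D′ p) ,
       ((λ p → proj₁) , E⋐̸D , λ ζ ζ≺ξ → thin-⊆ (λ p _ ((_ , ¬D′p) , Ep) → Ep , ¬D′p) (by-contra (min ζ ζ≺ξ))) ,
       (λ p (_ , ¬D′p) → ¬D′p ∘ inj₁) , downward proj₁ (E-small ξ)

  Rank : Space → Pred Ord 0ℓ
  Rank x ξ = ⌊ (∃ λ a → Pure ξ a × (∀ p → a p → ones x p)) ⌋

  rank-⊆ : ∀ {x y ξ} → (∀ p → ones x p → ones y p) → Rank x ξ → Rank y ξ
  rank-⊆ x⊆y rank = let (a , pure , a⊆x) = unwrap rank in wrap (a , pure , λ p → x⊆y p ∘ a⊆x p)

  agree-ones : ∀ {D x y} → Agree D x y → ∀ {p} → D p → ones x p → ones y p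
  agree-ones x≈y Dp xp = ≡.trans (sym (x≈y _ Dp)) xp

  -- A pure set of rank below `λ₀` lies in `seal λ₀` up to a thin set, so its part there is still
  -- pure. Thus a set in `𝓘` controls all ranks below `λ₀`, which makes marks open conditions.
  rank-agree : ∀ {D x y λ₀} → Agree D x y → (∀ p → seal λ₀ p → D p) → ∀ {ξ} → ξ ≺ λ₀ → Rank x ξ → Rank y ξ
  rank-agree {λ₀ = λ₀} x≈y seal⊆D ξ≺λ rank =
    let (a , pure@(a⊆E , ¬thin , _) , a⊆x) = unwrap rank in
    wrap (_ , pure-⊆ {b = a ∩ seal λ₀} pure (λ p → proj₁)
      (λ thin → ¬thin (thin-⊆ (λ p _ ap → split a⊆E p ap) (thin-∪ thin (seal-bound ξ≺λ)))) ,
      λ p (ap , sp) → agree-ones x≈y (seal⊆D p sp) (a⊆x p ap))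
    where
    split : ∀ {a ξ} → (∀ p → a p → E ξ p) → ∀ p → a p → ((a ∩ seal λ₀) ∪ (λ p → E ξ p × ¬ seal λ₀ p)) p
    split a⊆E p ap with em (seal λ₀ p)
    ... | yes sp = inj₁ (ap , sp)
    ... | no ¬sp = inj₂ (a⊆E p ap , ¬sp)

  Limit : Space → Pred Ord 0ℓ
  Limit x γ = Labelled γ × Cofinalᶿ (Rank x) γ

  cofinal-below : ∀ {x y γ} → (∀ ξ → ξ ≺ γ → Rank x ξ → Rank y ξ) → Cofinalᶿ (Rank x) γ → Cofinalᶿ (Rank y) γ
  cofinal-below x⊆y (pos , cof) = pos , λ δ δ≺γ →
    let (β , rank , δ≺β , β≺γ) = cof δ δ≺γ in β , x⊆y β β≺γ rank , δ≺β , β≺γ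

  -- `x` has no rank from `λ₀` on, and its ranks below `λ₀` are frozen for all points that agree
  -- with it on `D`.
  SealedBelow : Space → Pred K 0ℓ → Ord → Set
  SealedBelow x D λ₀ = (∀ ξ → Rank x ξ → ξ ≺ λ₀) × (∀ p → seal λ₀ p → D p)

  -- Some `E ξ` is not almost contained in `D`, whereas `seal λ₀` almost contains `E ξ` as soon as
  -- `ξ ≺ λ₀`.
  seals-bounded : ∀ D → D ∈ 𝓘 → ∃ λ β → ∀ λ₀ → (∀ p → seal λ₀ p → D p) → λ₀ ≼ β
  seals-bounded D small = let (ξ , ¬bound) = ¬∀⇒∃¬ (E-unbounded D small) in
    ξ , λ λ₀ seal⊆D ξ≺λ → ¬bound (⋐-trans (seal-bound ξ≺λ) (⊆⇒⋐ seal⊆D))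

  -- A new limit point γ of ranks arises from adding pure sets of an increasing
  -- ω-sequence of ranks above all existing ones.

  record Extension (y : Space) (D : Pred K 0ℓ) (k : K) : Set₁ where
    field
      point     : Space
      domain    : Pred K 0ℓ
      γ λ₀      : Ord
      D⊆        : D ⊆ domain
      small     : domain ∈ 𝓘
      agree     : Agree D y point
      supported : ∀ p → ¬ domain p → point p ≡ off
      label     : Label k γ
      cofinal   : Cofinalᶿ (Rank point) γ
      above     : ∀ λ′ → (∀ p → seal λ′ p → D p) → λ′ ≺ γ
      γ≺λ       : γ ≺ λ₀
      sealed    : SealedBelow point domain λ₀
      older     : ∀ δ → Limit point δ → δ ≡ γ ⊎ (Limit y δ × δ ≺ γ)
      kept      : ∀ δ → Cofinalᶿ (Rank y) δ → Cofinalᶿ (Rank point) δ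

  module AddLimit
    (y : Space) (D : Pred K 0ℓ) (D-small : D ∈ 𝓘) (k : K)
    (β : Ord) (y-below : ∀ ξ → Rank y ξ → ξ ≺ β) (seals-below : ∀ λ′ → (∀ p → seal λ′ p → D p) → λ′ ≼ β)
    (beyond : Ord → Ord) (beyond> : ∀ η → η ≺ beyond η)
    (piece : Ord → Pred K 0ℓ) (piece-pure : ∀ η → Pure (beyond η) (piece η))
    (piece-outside : ∀ η p → piece η p → ¬ (D ∪ seal β) p) (piece-small : ∀ η → piece η ∈ 𝓘)
    (γ : Ord) (γ-label : Label k γ) (closed : ∀ δ → δ ≺ γ → beyond δ ≺ γ) (β≺γ : β ≺ γ)
    (c : ℕ → Ord) (c≺γ : ∀ n → c n ≺ γ) (c-cofinal : ∀ δ → δ ≺ γ → ∃ λ n → δ ≺ c n)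
    (λ₀ : Ord) (γ≺λ : γ ≺ λ₀)
    where

    private
      D₁ : Pred K 0ℓ
      D₁ = D ∪ seal β

      D₁-small : D₁ ∈ 𝓘
      D₁-small = ∪-small D-small (seal-small β)

      start : ℕ → Ord
      start zero    = O.max β (c 0)
      -- `beyond (start n)` makes the ranks increase, `c (suc n)` makes them cofinal in `γ`.
      start (suc n) = O.max (beyond (start n)) (c (suc n))

      r : ℕ → Ord
      r n = beyond (start n)

      start≺γ : ∀ n → start n ≺ γ
      start≺γ zero    = O.max-< β≺γ (c≺γ 0)
      start≺γ (suc n) = O.max-< (closed _ (start≺γ n)) (c≺γ (suc n))

      r≺γ : ∀ n → r n ≺ γ
      r≺γ n = closed _ (start≺γ n)

      r-step : ∀ n → r n ≺ r (suc n)
      r-step n = O.≤-<-trans (O.max-≤ˡ _ _) (beyond> (start (suc n)))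

      r-mono : ∀ {m n} → m ℕ.≤ n → r m ≼ r n
      r-mono {n = zero}  ℕ.z≤n = O.≤-refl
      r-mono {m} {suc n} m≤n with ℕ.m≤n⇒m<n∨m≡n m≤n
      ... | inj₁ (ℕ.s≤s m≤n′) = O.≤-trans (r-mono m≤n′) (O.<⇒≤ (r-step n))
      ... | inj₂ refl          = O.≤-refl

      r-next : ∀ {m n} → r m ≺ r n → r (suc m) ≼ r n
      r-next {m} {n} lt with ℕ.<-cmp m n
      ... | tri< m<n _ _  = r-mono m<n
      ... | tri≈ _ refl _ = ⊥-elim (O.<-irrefl lt)
      ... | tri> _ _ n<m  = ⊥-elim (r-mono (ℕ.<⇒≤ n<m) lt)

      β≺r : ∀ n → β ≺ r n
      β≺r n = O.<-≤-trans (O.≤-<-trans (O.max-≤ˡ _ _) (beyond> (start 0))) (r-mono {0} {n} ℕ.z≤n)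

      c≺r : ∀ n → c n ≺ r n
      c≺r zero    = O.≤-<-trans (O.max-≤ʳ _ _) (beyond> (start 0))
      c≺r (suc n) = O.≤-<-trans (O.max-≤ʳ _ _) (beyond> (start (suc n)))

      a : Pred K 0ℓ
      a = ⋃ ℕ (piece ∘ start)

      x : Space
      x = overwrite D₁ y a

      rank-new : ∀ n → Rank x (r n)
      rank-new n = wrap (piece (start n) , piece-pure (start n) , λ p ap →
        overwrite-on D₁ y a p (piece-outside (start n) p ap) (n , ap))

      -- Ones of `y` outside `D₁` may be lost in `x`, but the ranks of `y` lie below `β` and `D₁`
      -- contains `seal β`.
      rank-old : ∀ ξ → Rank y ξ → Rank x ξ
      rank-old ξ rank = rank-agree {D = D₁} (overwrite-agree D₁ y a) (λ _ → inj₂) (y-below ξ rank) rank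

      -- A pure set of ones of `x` is covered by the ones of `y` and countably many pieces, so it
      -- meets one of these in a nonthin set. If that is a piece, `pure-unique` identifies the rank.
      rank-cases : ∀ ξ → Rank x ξ → Rank y ξ ⊎ ∃ λ n → ξ ≡ r n
      rank-cases ξ rank = let (b , pure , b⊆x) = unwrap rank in cases b pure b⊆x
        where
        cases : ∀ b → Pure ξ b → (∀ p → b p → ones x p) → Rank y ξ ⊎ ∃ λ n → ξ ≡ r n
        cases b pure@(_ , ¬thin , _) b⊆x with em (Thin (b ∩ ones y)) | em (∃ λ n → ¬ Thin (b ∩ piece (start n)))
        ... | no ¬thin′ | _ = inj₁ (wrap (_ , pure-⊆ {b = b ∩ ones y} pure (λ p → proj₁) ¬thin′ , λ p → proj₂))
        ... | yes _ | yes (n , ¬thin′) = inj₂ (n , pure-unique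
          (pure-⊆ {b = b ∩ piece (start n)} pure (λ p → proj₁) ¬thin′) (pure-⊆ (piece-pure (start n)) (λ p → proj₂) ¬thin′))
        ... | yes thin | no none = ⊥-elim (¬thin (thin-⊆ cover
          (thin-∪ thin (thin-⋃ℕ (λ n → b ∩ piece (start n)) λ n → by-contra λ ¬thin′ → none (n , ¬thin′)))))
          where
          cover : ∀ p → N p → b p → ((b ∩ ones y) ∪ ⋃ ℕ (λ n → b ∩ piece (start n))) p
          cover p _ bp = case overwrite-cases D₁ y a p (b⊆x p bp) of λ where
            (inj₁ (_ , yp))     → inj₁ (bp , yp)
            (inj₂ (_ , n , ap)) → inj₂ (n , bp , ap)

      x-below : ∀ ξ → Rank x ξ → ξ ≺ γ
      x-below ξ rank with rank-cases ξ rank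
      ... | inj₁ rank′      = O.<-trans (y-below ξ rank′) β≺γ
      ... | inj₂ (n , refl) = r≺γ n

      γ-cofinal : Cofinalᶿ (Rank x) γ
      γ-cofinal = (β , β≺γ) , λ δ δ≺γ → let (n , δ≺c) = c-cofinal δ δ≺γ in
        r n , rank-new n , O.<-trans δ≺c (c≺r n) , r≺γ n

      -- The ranks of `x` above `β` are the `r n`, an increasing sequence of type ω with supremum
      -- `γ`; a limit above `β` exceeds all of them by induction.
      no-limit-between : ∀ {δ} → β ≺ δ → δ ≺ γ → ¬ Cofinalᶿ (Rank x) δ
      no-limit-between {δ} β≺δ δ≺γ (_ , cof) = let (n , δ≺c) = c-cofinal δ δ≺γ in
        O.<-irrefl (O.<-trans (O.<-trans δ≺c (c≺r n)) (r≺δ n))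
        where
        rank-above : ∀ ε → β ≼ ε → ε ≺ δ → ∃ λ n → ε ≺ r n × r n ≺ δ
        rank-above ε β≼ε ε≺δ with cof ε ε≺δ
        ... | ξ , rank , ε≺ξ , ξ≺δ with rank-cases ξ rank
        ...   | inj₁ rank′      = ⊥-elim (β≼ε (O.<-trans ε≺ξ (y-below ξ rank′)))
        ...   | inj₂ (n , refl) = n , ε≺ξ , ξ≺δ
        r≺δ : ∀ n → r n ≺ δ
        r≺δ zero    = let (n , _ , rn≺δ) = rank-above β O.≤-refl β≺δ in O.≤-<-trans (r-mono {0} {n} ℕ.z≤n) rn≺δ
        r≺δ (suc m) = let (n , rm≺rn , rn≺δ) = rank-above (r m) (O.<⇒≤ (β≺r m)) (r≺δ m) in
          O.≤-<-trans (r-next {m} {n} rm≺rn) rn≺δ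

      older : ∀ δ → Limit x δ → δ ≡ γ ⊎ (Limit y δ × δ ≺ γ)
      older δ (lab , cof) with O.compare δ γ
      ... | tri≈ _ eq _  = inj₁ eq
      ... | tri> _ _ γ≺δ = let (ξ , rank , γ≺ξ , _) = proj₂ cof γ γ≺δ in ⊥-elim (O.<-irrefl (O.<-trans γ≺ξ (x-below ξ rank)))
      ... | tri< δ≺γ _ _ with O.<⊎≥ β δ
      ...   | inj₁ β≺δ = ⊥-elim (no-limit-between β≺δ δ≺γ cof)
      ...   | inj₂ δ≼β = inj₂ ((lab , cofinal-below only-old cof) , δ≺γ)
        where
        only-old : ∀ ξ → ξ ≺ δ → Rank x ξ → Rank y ξ
        only-old ξ ξ≺δ rank with rank-cases ξ rank
        ... | inj₁ rank′      = rank′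
        ... | inj₂ (n , refl) = ⊥-elim (O.<-irrefl (O.<-trans (O.<-≤-trans ξ≺δ δ≼β) (β≺r n)))

    extension : Extension y D k
    extension = record
      { point     = x
      ; domain    = D₁ ∪ (a ∪ seal λ₀)
      ; γ         = γ
      ; λ₀        = λ₀
      ; D⊆        = inj₁ ∘ inj₁
      ; small     = ∪-small D₁-small (∪-small (⋃ℕ-small _ λ n → piece-small (start n)) (seal-small λ₀))
      ; agree     = λ p Dp → overwrite-agree D₁ y a p (inj₁ Dp)
      ; supported = λ p out → overwrite-off D₁ y a p (out ∘ inj₁) (out ∘ inj₂ ∘ inj₁)
      ; label     = γ-label
      ; cofinal   = γ-cofinal
      ; above     = λ λ′ seal⊆D → O.≤-<-trans (seals-below λ′ seal⊆D) β≺γ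
      ; γ≺λ       = γ≺λ
      ; sealed    = (λ ξ rank → O.<-trans (x-below ξ rank) γ≺λ) , λ p sp → inj₂ (inj₂ sp)
      ; older     = older
      ; kept      = λ δ → cofinal-below λ ξ _ → rank-old ξ
      }

  abstract
    add-limit : ∀ y β₀ → (∀ ξ → Rank y ξ → ξ ≺ β₀) → ∀ D → D ∈ 𝓘 → ∀ k → Extension y D k
    add-limit y β₀ below D D-small k =
      let (β₁ , seals) = seals-bounded D D-small
          β = O.max β₀ β₁
          outside = pure-outside (D ∪ seal β) (∪-small D-small (seal-small β))
          (γ , label , (_ , closed) , β≺γ) = stationaryᶿ-above (label-stationary k) (λ η → proj₁ (outside η)) β
          (c , c≺γ , c-cofinal) = label-cofinality label
          (λ₀ , γ≺λ) = unboundedᶿ γ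
      in AddLimit.extension y D D-small k
        β (λ ξ rank → O.<-≤-trans (below ξ rank) (O.max-≤ˡ β₀ β₁)) (λ λ′ seal⊆D → O.≤-trans (seals λ′ seal⊆D) (O.max-≤ʳ β₀ β₁))
        (λ η → proj₁ (outside η)) (λ η → proj₁ (proj₂ (outside η)))
        (λ η → proj₁ (proj₂ (proj₂ (outside η)))) (λ η → proj₁ (proj₂ (proj₂ (proj₂ (outside η)))))
        (λ η → proj₁ (proj₂ (proj₂ (proj₂ (proj₂ (outside η)))))) (λ η → proj₂ (proj₂ (proj₂ (proj₂ (proj₂ (outside η))))))
        γ label closed β≺γ c c≺γ c-cofinal λ₀ γ≺λ

-- Marks as pairs of adjacent limit points.

module AdjacentLimits (cl : Classical) (κ : WellOrder) (uncountableRegular : IsUncountableRegular κ)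
                      (𝓘 : Family (Carrier κ)) (ideal : IsCompleteProperIdeal κ 𝓘) (containsBounded : ContainsBounded κ 𝓘)
                      (ν : Base)
                      (¬splitting : ¬ DisjointPositive.Splitting cl κ uncountableRegular 𝓘 ideal containsBounded ν)
                      (minimal : Saturated.MinimalFunction cl κ uncountableRegular 𝓘 ideal containsBounded ν) where
  open Space cl κ uncountableRegular 𝓘 ideal containsBounded ν
  open Diagonal cl κ uncountableRegular 𝓘 ideal containsBounded ν using (Marks; Stage; Coherent; module Coherent)
  open LongOrder.Construction cl κ uncountableRegular 𝓘 ideal containsBounded ν ¬splitting minimal
  open LongMarks cl κ uncountableRegular 𝓘 ideal containsBounded ν ¬splitting minimal
  open Stage

  private
    open O using () renaming (_<_ to _≺_; _≤_ to _≼_)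
    Ord = Carrier Θ
    open Stationarity cl Θ Θ-regular using () renaming (Cofinal to Cofinalᶿ)

    first second : K → K
    first k  = pair (nat 0) k
    second k = pair (nat 1) k

    first≢second : ∀ {j k} → first j ≢ second k
    first≢second eq = case nat-injective {0} {1} (proj₁ (pair-injective eq)) of λ ()

  -- The limit points of ranks need not be stable at limits of the
  -- construction, but a new one always has cofinally many others below it.
  -- So a mark is a pair of adjacent limit points with matching labels.

  MarkAt : K → Space → Ord → Ord → Set
  MarkAt k x γ δ = Label (first k) γ × Label (second k) δ × γ ≺ δ ×
                   Cofinalᶿ (Rank x) γ × Cofinalᶿ (Rank x) δ × (∀ ε → γ ≺ ε → ε ≺ δ → ¬ Limit x ε)

  Mark′ : K → Pred Space 0ℓ
  Mark′ k x = ∃₂ (MarkAt k x)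

  -- Cofinality in `γ` and `δ` and the absence of limits in between refer only to ranks below `δ`.
  mark-transfer : ∀ {k x y γ δ λ₀} → δ ≼ λ₀ →
                  (∀ ξ → ξ ≺ λ₀ → Rank x ξ → Rank y ξ) → (∀ ξ → ξ ≺ λ₀ → Rank y ξ → Rank x ξ) →
                  MarkAt k x γ δ → MarkAt k y γ δ
  mark-transfer δ≼λ x⊆y y⊆x (lab , lab′ , γ≺δ , cof , cof′ , adjacent) =
    lab , lab′ , γ≺δ ,
    cofinal-below (λ ξ ξ≺γ → x⊆y ξ (O.<-≤-trans (O.<-trans ξ≺γ γ≺δ) δ≼λ)) cof ,
    cofinal-below (λ ξ ξ≺δ → x⊆y ξ (O.<-≤-trans ξ≺δ δ≼λ)) cof′ ,
    λ ε γ≺ε ε≺δ (lab″ , cof″) → adjacent ε γ≺ε ε≺δ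
      (lab″ , cofinal-below (λ ξ ξ≺ε → y⊆x ξ (O.<-≤-trans (O.<-trans ξ≺ε ε≺δ) δ≼λ)) cof″)

  mark-agree : ∀ {k x y γ δ λ₀ D} → δ ≼ λ₀ → Agree D x y → (∀ p → seal λ₀ p → D p) → MarkAt k x γ δ → MarkAt k y γ δ
  mark-agree δ≼λ x≈y seal⊆D = mark-transfer δ≼λ
    (λ ξ ξ≺λ → rank-agree x≈y seal⊆D ξ≺λ) (λ ξ ξ≺λ → rank-agree (λ p Dp → sym (x≈y p Dp)) seal⊆D ξ≺λ)

  -- A `p` in `N` still undecided at stage `π p` is switched off by then, so its value `on` can only
  -- come from a stage before `π p`.
  early′ : K → Pred K 0ℓ
  early′ t p = N p × π p ≤ t

  Good′ : Pred Space 0ℓ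
  Good′ x = ∃ λ β → ∀ ξ → Rank x ξ → ξ ≺ β

  -- With `D` the base of a stage, this gives a labelled limit point above the levels of all earlier
  -- stages. In `marks-source` it separates two limit points that would become adjacent only at a
  -- limit of the construction.
  Progress : Pred K 0ℓ → Space → Set
  Progress D x = ∃ λ γ → Limit x γ × (∀ λ′ → (∀ p → seal λ′ p → D p) → λ′ ≺ γ)

  Sealed′ : Pred K 0ℓ → Space → Pred K 0ℓ → Set₁
  Sealed′ D x F = Lift _ ((∃ λ λ₀ → SealedBelow x F λ₀) × Progress D x)

  -- Two limit points with matching labels are added in succession. No limit of the intermediate
  -- point is above its new one, so nothing comes between the two.
  set-mark′ : ∀ y → Good′ y → ∀ D → D ∈ 𝓘 → ∀ k → ∃₂ λ x F →
              D ⊆ F × F ∈ 𝓘 × Agree D y x × (∀ p → ¬ F p → x p ≡ off) × Good′ x × Sealed′ D x F ×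
              (∀ z → Agree F x z → Mark′ k z) × (∀ j → Mark′ j x → j ≡ k ⊎ Mark′ j y)
  set-mark′ y (β , below) D small k =
    X₂.point , X₂.domain , (λ Dp → X₂.D⊆ (X₁.D⊆ Dp)) , X₂.small ,
    (λ p Dp → ≡.trans (X₁.agree p Dp) (X₂.agree p (X₁.D⊆ Dp))) , X₂.supported , (X₂.λ₀ , proj₁ X₂.sealed) ,
    lift ((X₂.λ₀ , X₂.sealed) , X₂.γ , ((_ , X₂.label) , X₂.cofinal) , λ λ′ seal⊆D → X₂.above λ′ (λ p sp → X₁.D⊆ (seal⊆D p sp))) ,
    (λ z x≈z → X₁.γ , X₂.γ , mark-agree (O.<⇒≤ X₂.γ≺λ) x≈z (proj₂ X₂.sealed) marked) , only
    where
    module X₁ = Extension (add-limit y β below D small (first k))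
    module X₂ = Extension (add-limit X₁.point X₁.λ₀ (proj₁ X₁.sealed) X₁.domain X₁.small (second k))
    γ≺γ : X₁.γ ≺ X₂.γ
    γ≺γ = O.<-trans X₁.γ≺λ (X₂.above X₁.λ₀ (proj₂ X₁.sealed))
    older₁ : ∀ {ε} → Limit X₁.point ε → ε ≼ X₁.γ
    older₁ lim with X₁.older _ lim
    ... | inj₁ refl      = O.≤-refl
    ... | inj₂ (_ , ε≺γ) = O.<⇒≤ ε≺γ
    marked : MarkAt k X₂.point X₁.γ X₂.γ
    marked = X₁.label , X₂.label , γ≺γ , X₂.kept _ X₁.cofinal , X₂.cofinal , λ ε γ≺ε ε≺γ lim →
      case X₂.older ε lim of λ where
        (inj₁ refl)       → O.<-irrefl ε≺γ
        (inj₂ (lim′ , _)) → older₁ lim′ γ≺ε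
    only : ∀ j → Mark′ j X₂.point → j ≡ k ⊎ Mark′ j y
    only j (γ , δ , lab , lab′ , γ≺δ , cof , cof′ , adjacent) with X₂.older δ ((_ , lab′) , cof′)
    -- wait
    ... | inj₁ refl = inj₁ (proj₂ (pair-injective (label-disjoint lab′ X₂.label)))
    ... | inj₂ (lim , _) with X₁.older δ lim
    ...   | inj₁ refl = ⊥-elim (first≢second (sym (label-disjoint lab′ X₁.label)))
    ...   | inj₂ (lim′ , δ≺γ₁) with X₂.older γ ((_ , lab) , cof)
    ...     | inj₁ refl = ⊥-elim (O.<-irrefl (O.<-trans (O.<-trans γ≺γ γ≺δ) δ≺γ₁))
    ...     | inj₂ (lim″ , _) with X₁.older γ lim″
    ...       | inj₁ refl = ⊥-elim (O.<-irrefl (O.<-trans γ≺δ δ≺γ₁))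
    ...       | inj₂ (lim‴ , _) = inj₂ (γ , δ , lab , lab′ , γ≺δ , proj₂ lim‴ , proj₂ lim′ ,
                  λ ε γ≺ε ε≺δ (labelled , cof″) → adjacent ε γ≺ε ε≺δ (labelled , X₂.kept ε (X₁.kept ε cof″)))

  module AtLimit (J : Pred K 0ℓ) (down : ∀ {u t} → J t → u < t → J u) (h : K → Stage)
                 (coherent : ∀ t → J t → Coherent early′ Sealed′ t (λ u _ → h u) (h t))
                 (x : Space) (agree : ∀ t → J t → Agree (domain (h t)) (point (h t)) x)
                 (offs : ∀ p → (∀ t → J t → ¬ domain (h t) p) → x p ≡ off) where

    private
      level′ : K → Ord
      level′ t with em (J t)
      ... | yes Jt = proj₁ (proj₁ (lower (Coherent.sealed (coherent t Jt))))
      ... | no _   = some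

      sealedAt : ∀ t → J t → SealedBelow (point (h t)) (domain (h t)) (level′ t)
      sealedAt t Jt with em (J t)
      ... | yes Jt′ = proj₂ (proj₁ (lower (Coherent.sealed (coherent t Jt′))))
      ... | no ¬Jt  = ⊥-elim (¬Jt Jt)

      ones-domain : ∀ {t} → J t → ∀ {p} → ones (point (h t)) p → domain (h t) p
      ones-domain Jt xp = by-contra λ out → on≢off (≡.trans (sym xp) (Coherent.supported (coherent _ Jt) _ out))

      grow : ∀ {u t} → J t → u ≤ t → domain (h u) ⊆ domain (h t)
      grow Jt u≤t with ≤⇒<⊎≡ u≤t
      ... | inj₁ u<t  = Coherent.later (coherent _ Jt) _ u<t
      ... | inj₂ refl = λ Dp → Dp

      rank-grow : ∀ {u t ξ} → J u → J t → u ≤ t → Rank (point (h u)) ξ → Rank (point (h t)) ξ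
      rank-grow Ju Jt u≤t = rank-⊆ λ p up → let Dup = ones-domain Ju up in
        ≡.trans (agree _ Jt p (grow Jt u≤t Dup)) (≡.trans (sym (agree _ Ju p Dup)) up)

      Piece : Pred K 0ℓ → K → Pred K 0ℓ
      Piece a t p = a p × J t × ones (point (h t)) p

      -- A point of N is set at a stage before its π-value, so normality
      -- of the thin sets applies.

      decided-early : ∀ a → (∀ p → a p → ones x p) → ∀ p → N p → a p → ∇ (Piece a) p
      decided-early a a⊆x p Np ap =
        let (t , (Jt , Dtp) , min) = least (λ t → J t × domain (h t) p) (by-contra λ none →
              on≢off (≡.trans (sym (a⊆x p ap)) (offs p λ t Jt Dtp → none (t , Jt , Dtp))))
            xp = ≡.trans (agree t Jt p Dtp) (a⊆x p ap)
        in Np , t , by-contra (λ π≤t → on≢off (≡.trans (sym xp) (Coherent.delayed (coherent t Jt) p (Np , π≤t)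
             λ u u<t Dup → min u u<t (down Jt u<t , Dup)))) , ap , Jt , xp

      rank-source : ∀ {ξ} → Rank x ξ → ∃ λ t → J t × Rank (point (h t)) ξ
      rank-source rank =
        let (a , pure@(_ , ¬thin , _) , a⊆x) = unwrap rank
            (t , ¬thin′) = ¬∀⇒∃¬ λ thin → ¬thin (thin-⊆ (decided-early a a⊆x) (thin-∇ (Piece a) thin))
        in t , by-contra (λ ¬Jt → ¬thin′ (id , λ p _ (_ , Jt , _) → ⊥-elim (¬Jt Jt))) ,
           wrap (Piece a t , pure-⊆ pure (λ p → proj₁) ¬thin′ , λ p (_ , _ , xp) → xp)

      rank-up : ∀ {t} → J t → ∀ ξ → Rank (point (h t)) ξ → Rank x ξ
      rank-up Jt ξ rank = let (bound , seal⊆D) = sealedAt _ Jt in rank-agree (agree _ Jt) seal⊆D (bound ξ rank) rank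

    good : Good′ x
    good = let (β , below) = K-bounded level′ in β , λ ξ rank →
      let (t , Jt , rank′) = rank-source rank in O.<-trans (proj₁ (sealedAt t Jt) ξ rank′) (below t)

    marks-source : ∀ k → Mark′ k x → ∃ λ t → J t × (∀ u → J u → t ≤ u → Mark′ k (point (h u)))
    marks-source k (γ , δ , mark@(_ , _ , γ≺δ , _ , (_ , cof) , adjacent)) with em (∃ λ t → J t × δ ≼ level′ t)
    ... | yes (t , Jt , δ≼λ) = t , Jt , λ u Ju t≤u → γ , δ , mark-agree δ≼λ
      (λ p Dp → ≡.trans (sym (agree t Jt p Dp)) (same u Ju t≤u p Dp)) (proj₂ (sealedAt t Jt)) mark
      where
      same : ∀ u → J u → t ≤ u → ∀ p → domain (h t) p → point (h t) p ≡ point (h u) p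
      same u Ju t≤u p Dp = ≡.trans (agree t Jt p Dp) (sym (agree u Ju p (grow Ju t≤u Dp)))
    ... | no none =
      let (ξ , rank , γ≺ξ , ξ≺δ) = cof γ γ≺δ
          (t , Jt , rank′) = rank-source rank
          λ≺δ : ∀ {t} → J t → level′ t ≺ δ
          λ≺δ Jt = by-contra λ δ≼λ → none (_ , Jt , δ≼λ)
          (ζ , rankζ , λ≺ζ , _) = cof (level′ t) (λ≺δ Jt)
          (u , Ju , rankζ′) = rank-source rankζ
          t<u = by-contra {A = t < u} λ u≤t →
            O.<-irrefl (O.<-trans λ≺ζ (proj₁ (sealedAt t Jt) ζ (rank-grow Ju Jt u≤t rankζ′)))
          (ε , (labelled , cofε) , above) = proj₂ (lower (Coherent.sealed (coherent u Ju)))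
          λ≺ε = above (level′ t) (λ p sp → Coherent.base-⊇ (coherent u Ju) t t<u (proj₂ (sealedAt t Jt) p sp))
          ε≼λ : ε ≼ level′ u
          ε≼λ = λ λ≺ε → let (η , rankη , λ≺η , _) = proj₂ cofε (level′ u) λ≺ε in
            O.<-irrefl (O.<-trans λ≺η (proj₁ (sealedAt u Ju) η rankη))
      in ⊥-elim (adjacent ε (O.<-trans (O.<-trans γ≺ξ (proj₁ (sealedAt t Jt) ξ rank′)) λ≺ε) (O.≤-<-trans ε≼λ (λ≺δ Ju))
           (labelled , cofinal-below (λ η _ → rank-up Ju η) cofε))

  long-marks : Marks
  long-marks = record
    { early       = early′
    ; early-small = λ t → let (t⁺ , t<t⁺) = unbounded t in
        downward (λ (Np , π≤t) → Np , ≤-<-trans π≤t t<t⁺) (unbounded-π t⁺)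
    ; Good        = Good′
    ; Mark        = Mark′
    ; Sealed      = Sealed′
    ; mark-local  = λ k x (γ , δ , mark) → seal δ , seal-small δ , λ y x≈y → γ , δ , mark-agree O.≤-refl x≈y (λ _ sp → sp) mark
    ; set-mark    = set-mark′
    ; limit       = λ J down h coherent x agree offs →
        let open AtLimit J down h coherent x agree offs in good , marks-source
    }

module Borel (cl : Classical) (κ : WellOrder) (uncountableRegular : IsUncountableRegular κ)
             (𝓘 : Family (Carrier κ)) (ideal : IsCompleteProperIdeal κ 𝓘) (containsBounded : ContainsBounded κ 𝓘)
             (ν : Base) where
  open Space cl κ uncountableRegular 𝓘 ideal containsBounded ν
  open Diagonal cl κ uncountableRegular 𝓘 ideal containsBounded ν using (Marks; module Marks; Read; fixed-point)

  open-∅ : ∅ ∈ Open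
  open-∅ = local⇒open λ _ ()

  open-const : (P : Set) → (λ _ → P) ∈ Open
  open-const P = local⇒open λ _ p → ∅ , empty , λ _ _ → p

  Bool↣K : Bool ↣ K
  Bool↣K = mk↣ {to = bit} bit-injective

  K↣K : K ↣ K
  K↣K = mk↣ {to = id} id

  bor-∪ : ∀ {A B} → A ∈ Bor → B ∈ Bor → A ∪ B ∈ Bor
  bor-∪ {A} {B} bA bB = Bor.resp
    ((λ { (true , Ax) → inj₁ Ax ; (false , Bx) → inj₂ Bx }) , λ { (inj₁ Ax) → true , Ax ; (inj₂ Bx) → false , Bx })
    (Bor.union Bool↣K (λ b → if b then A else B) λ { true → bA ; false → bB })

  bor-∩ : ∀ {A B} → A ∈ Bor → B ∈ Bor → A ∩ B ∈ Bor
  bor-∩ {A} {B} bA bB = Bor.resp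
    ((λ ¬¬ → by-contra (λ ¬A → ¬¬ (inj₁ ¬A)) , by-contra (λ ¬B → ¬¬ (inj₂ ¬B))) , λ { (a , b) → [ (λ ¬A → ¬A a) , (λ ¬B → ¬B b) ]′ })
    (complement (bor-∪ (complement bA) (complement bB)))

  bor-const : (P : Set) → (λ _ → P) ∈ Bor
  bor-const P = open′ (open-const P)

  bor-last : (M : K → Bool → Pred Space 0ℓ) → (∀ j b → M j b ∈ Bor) →
             (λ x → ∃ λ j → M j true x × (∀ j′ b → j < j′ → ¬ M j′ b x)) ∈ Bor
  bor-last M bM = Bor.union K↣K _ λ j → bor-∩ (bM j true) (Bor.resp
    ((λ ¬∃ j′ b j<j′ m → ¬∃ (j′ , b , j<j′ , m)) , λ ∀¬ (j′ , b , j<j′ , m) → ∀¬ j′ b j<j′ m)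
    (complement (Bor.union K↣K (λ j′ x → ∃ λ b → j < j′ × M j′ b x) λ j′ →
      Bor.union Bool↣K (λ b x → j < j′ × M j′ b x) λ b → bor-∩ (bor-const (j < j′)) (bM j′ b))))

  bor-read : (marks : Marks) → ∀ s → Read marks s ∈ Bor
  bor-read marks s = bor-last (λ j b → Marks.Mark marks (pair s (pair j (bit b)))) λ j b →
    open′ (local⇒open (Marks.mark-local marks _))

  -- Every Σ⁰ set of level at most α is obtained from a family of open sets,
  -- indexed by lists over κ × κ and a bit, in a way that depends on α only.
  -- The sets with bit `false` switch branches on and off; the one at the
  -- empty list is never used.

  module Evaluation (W : WellOrder) (α : Carrier W) (f : Carrier W → K)
                    (f-injective : ∀ {β γ} → WellOrder._<_ W β α → WellOrder._<_ W γ α → f β ≡ f γ → β ≡ γ) where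
    private module W = Order cl W

    Code : Set₁
    Code = List (K × K) → Bool → Pred Space 0ℓ

    shift : K × K → Code → Code
    shift a c l b = c (a ∷ l) b

    Ev : ∀ β → Acc W._<_ β → Code → Pred Space 0ℓ
    Ev β (acc rs) c x = c [] true x ⊎ ∃ λ γ → ∃ λ β′ → Σ (β′ W.< β) λ β′<β →
      c ((f β′ , γ) ∷ []) false x × ¬ Ev β′ (rs β′<β) (shift (f β′ , γ) c) x

    Same : Code → Code → Space → Set
    Same c d x = (∀ l → (c l true x → d l true x) × (d l true x → c l true x)) ×
                 (∀ a l → (c (a ∷ l) false x → d (a ∷ l) false x) × (d (a ∷ l) false x → c (a ∷ l) false x))

    same-sym : ∀ {c d x} → Same c d x → Same d c x
    same-sym (s , s′) = (λ l → proj₂ (s l) , proj₁ (s l)) , λ a l → proj₂ (s′ a l) , proj₁ (s′ a l)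

    same-shift : ∀ {c d x} a → Same c d x → Same (shift a c) (shift a d) x
    same-shift a (s , s′) = (λ l → s (a ∷ l)) , λ b l → s′ a (b ∷ l)

    ev-cong : ∀ {β} (A A′ : Acc W._<_ β) {c d x} → Same c d x → Ev β A c x → Ev β A′ d x
    ev-cong (acc rs) (acc rs′) (s , _) (inj₁ root) = inj₁ (proj₁ (s []) root)
    ev-cong (acc rs) (acc rs′) {c} {d} {x} same@(_ , s′) (inj₂ (γ , β′ , β′<β , switch , ¬ev)) =
      inj₂ (γ , β′ , β′<β , proj₁ (s′ _ []) switch , λ ev →
        ¬ev (ev-cong (rs′ β′<β) (rs β′<β) (same-sym {shift _ c} {shift _ d} (same-shift {c} {d} _ same)) ev))

    ev-bor : ∀ β (A : Acc W._<_ β) → (∀ {β′} → β′ W.< β → β′ W.< α) → ∀ c → (∀ l b → c l b ∈ Bor) → Ev β A c ∈ Bor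
    ev-bor β (acc rs) below c bc = bor-∪ (bc [] true) (Bor.resp
      ((λ { ((_ , γ) , β′ , β′<β , refl , s , ¬ev) → γ , β′ , β′<β , s , ¬ev }) ,
       λ (γ , β′ , β′<β , s , ¬ev) → (f β′ , γ) , β′ , β′<β , refl , s , ¬ev)
      (Bor.union pairing (λ (i , γ) x → ∃ λ β′ → Σ (β′ W.< β) λ β′<β → f β′ ≡ i × Branch β′ β′<β γ x) λ (i , γ) → branch i γ))
      where
      Branch : ∀ β′ → β′ W.< β → K → Pred Space 0ℓ
      Branch β′ β′<β γ x = c ((f β′ , γ) ∷ []) false x × ¬ Ev β′ (rs β′<β) (shift (f β′ , γ) c) x
      branch : ∀ i γ → (λ x → ∃ λ β′ → Σ (β′ W.< β) λ β′<β → f β′ ≡ i × Branch β′ β′<β γ x) ∈ Bor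
      branch i γ with em (∃ λ β′ → β′ W.< β × f β′ ≡ i)
      ... | no none = Bor.resp ((λ ()) , λ (β′ , β′<β , eq , _) → none (β′ , β′<β , eq)) (bor-const ⊥)
      ... | yes (β′ , β′<β , refl) = Bor.resp
        ((λ b → β′ , β′<β , refl , b) , λ (β″ , β″<β , eq , b) → move (f-injective (below β″<β) (below β′<β) eq) β″<β b)
        (bor-∩ (bc _ false) (complement (ev-bor β′ (rs β′<β) (λ lt → below (W.<-trans lt β′<β)) _ λ l b → bc _ b)))
        where
        move : ∀ {β″ x} → β″ ≡ β′ → (β″<β : β″ W.< β) → Branch β″ β″<β γ x → Branch β′ β′<β γ x
        move {x = x} refl β″<β (s , ¬ev) = s , λ ev → ¬ev (ev-cong (rs β′<β) (rs β″<β) {c = shift _ c} {x = x}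
          ((λ l → id , id) , λ a l → id , id) ev)

    record Represents (β : Carrier W) (A : Acc W._<_ β) (B : Pred Space 0ℓ) : Set₁ where
      field
        code  : Code
        opens : ∀ l b → code l b ∈ Open
        to    : ∀ x → B x → Ev β A code x
        from  : ∀ x → Ev β A code x → B x

    represent : ∀ β (A : Acc W._<_ β) → (∀ {β′} → β′ W.< β → β′ W.< α) → ∀ {B} → B ∈ Σ⁰ W β → Represents β A B
    represent β (acc rs) below {B} (one _ oB) = record
      { code  = code
      ; opens = opens
      ; to    = λ x Bx → inj₁ Bx
      ; from  = λ x → λ { (inj₁ Bx) → Bx ; (inj₂ (_ , _ , _ , () , _)) }
      }
      where
      code : Code
      code []      true  = B
      code []      false = ∅
      code (_ ∷ _) _     = ∅
      opens : ∀ l b → code l b ∈ Open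
      opens []      true  = oB
      opens []      false = open-∅
      opens (_ ∷ _) _     = open-∅
    represent β (acc rs) below {B} (step {B = B} A levels (B⊆ , ⊆B)) = record
      { code  = code
      ; opens = opens
      ; to    = λ x Bx → let (γ , Aγx) = B⊆ Bx in inj₂ (γ , level γ , level< γ , refl , λ ev →
          proj₁ (complements γ) Aγx (Represents.from (child γ) x (ev-cong _ _ (same γ x) ev)))
      ; from  = λ x → λ where
          (inj₁ ())
          (inj₂ (γ , β′ , β′<β , eq , ¬ev)) → ⊆B (γ , proj₂ (complements γ) λ A′x →
            ¬ev (move γ x β′<β (f-injective (below (level< γ)) (below β′<β) (sym eq)) (Represents.to (child γ) x A′x)))
      }
      where
      level : K → Carrier W
      level γ = proj₁ (levels γ)
      level< : ∀ γ → level γ W.< β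
      level< γ = proj₁ (proj₂ (proj₂ (levels γ)))
      dual : ∀ {β′ C} → C ∈ Π⁰ W β′ → ∃ λ C′ → C′ ∈ Σ⁰ W β′ × C ≐ ∁ C′
      dual (compl σ eq) = _ , σ , eq
      complements : ∀ γ → A γ ≐ ∁ (proj₁ (dual (proj₂ (proj₂ (proj₂ (levels γ))))))
      complements γ = proj₂ (proj₂ (dual (proj₂ (proj₂ (proj₂ (levels γ))))))
      child : ∀ γ → Represents (level γ) (rs (level< γ)) (proj₁ (dual (proj₂ (proj₂ (proj₂ (levels γ))))))
      child γ = represent (level γ) (rs (level< γ)) (λ lt → below (W.<-trans lt (level< γ)))
                          (proj₁ (proj₂ (dual (proj₂ (proj₂ (proj₂ (levels γ)))))))
      code : Code
      code []              _     = ∅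
      code ((i , γ) ∷ [])  false = λ _ → i ≡ f (level γ)
      code ((i , γ) ∷ [])  true  = Represents.code (child γ) [] true
      code ((i , γ) ∷ a ∷ l) b   = Represents.code (child γ) (a ∷ l) b
      opens : ∀ l b → code l b ∈ Open
      opens []                _     = open-∅
      opens ((i , γ) ∷ [])    false = open-const _
      opens ((i , γ) ∷ [])    true  = Represents.opens (child γ) [] true
      opens ((i , γ) ∷ a ∷ l) b     = Represents.opens (child γ) (a ∷ l) b
      same : ∀ {i} γ x → Same (shift (i , γ) code) (Represents.code (child γ)) x
      same γ x = (λ { [] → id , id ; (a ∷ l) → id , id }) , λ a l → id , id
      move : ∀ γ x {β′} (β′<β : β′ W.< β) → level γ ≡ β′ → Ev (level γ) (rs (level< γ)) (Represents.code (child γ)) x →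
             Ev β′ (rs β′<β) (shift (f β′ , γ) code) x
      move γ x β′<β refl ev = ev-cong _ _ (same-sym {shift (f (level γ) , γ) code} {Represents.code (child γ)} (same γ x)) ev

    -- A point whose marks answer the questions of the code of the complement
    -- of H belongs to H if and only if it does not.

    diagonal : ∀ {A : Acc W._<_ α} {reads : Code} (H : Represents α A (∁ (Ev α A reads))) x →
               (∀ l b → (reads l b x → Represents.code H l b x) × (Represents.code H l b x → reads l b x)) → ⊥
    diagonal {A} {reads} H x agree = case em (Ev α A reads x) of λ where
        (yes ev) → Represents.from H x (ev-cong A A {reads} {Represents.code H} same ev) ev
        (no ¬ev) → ¬ev (ev-cong A A {Represents.code H} {reads} (same-sym {reads} {Represents.code H} same) (Represents.to H x ¬ev))
      where
      same : Same reads (Represents.code H) x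
      same = (λ l → agree l true) , λ a l → agree (a ∷ l) false

    not-collapsed : Marks → ¬ (Σ⁰ W α ≐ Bor)
    not-collapsed marks (_ , Bor⊆Σ) =
      let A = W.wellFounded α
          H = represent α A id (Bor⊆Σ (complement (ev-bor α A id reads λ l b → bor-read marks (address l b))))
          (x , answers) = answered (Represents.code H) (Represents.opens H)
      in diagonal H x answers
      where
      reads : Code
      reads l b = Read marks (address l b)
      answered : ∀ c → (∀ l b → c l b ∈ Open) → ∃ λ x → ∀ l b → (reads l b x → c l b x) × (c l b x → reads l b x)
      answered c opens = let (x , fixed) = fixed-point marks O O-open in
        x , λ l b → (λ r → let (l′ , b′ , eq , cx) = proj₁ (fixed (address l b)) r in decode l′ b′ l b eq cx) ,
                    λ cx → proj₂ (fixed (address l b)) (l , b , refl , cx)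
        where
        O : K → Pred Space 0ℓ
        O s x = ∃ λ l → ∃ λ b → address l b ≡ s × c l b x
        O-open : ∀ s → O s ∈ Open
        O-open s = Generated.union {J = List (K × K)} _ λ l → Generated.union {J = Bool} _ λ b →
          Generated.inter (open-const (address l b ≡ s)) (opens l b)
        decode : ∀ l′ b′ l b {x} → address l′ b′ ≡ address l b → c l′ b′ x → c l b x
        decode l′ b′ l b {x} eq cx = let (l′≡l , b′≡b) = address-injective {l′} {l} {b′} {b} eq in
          subst (λ l → c l b x) l′≡l (subst (λ b → c l′ b x) b′≡b cx)

module Length (cl : Classical) (κ : WellOrder) (uncountableRegular : IsUncountableRegular κ)
              (𝓘 : Family (Carrier κ)) (ideal : IsCompleteProperIdeal κ 𝓘) (containsBounded : ContainsBounded κ 𝓘)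
              (ν : Base) (W : WellOrder) where
  open Space cl κ uncountableRegular 𝓘 ideal containsBounded ν
  open Borel cl κ uncountableRegular 𝓘 ideal containsBounded ν using (open-∅; K↣K)
  private module W = Order cl W

  Σ⇒Bor : ∀ {β A} → A ∈ Σ⁰ W β → A ∈ Bor
  Π⇒Bor : ∀ {β A} → A ∈ Π⁰ W β → A ∈ Bor
  Σ⇒Bor (one _ o)                = open′ o
  Σ⇒Bor (step A π (B⊆ , ⊆B)) = Bor.resp (⊆B , B⊆) (Bor.union K↣K A λ γ → Π⇒Bor (proj₂ (proj₂ (proj₂ (π γ)))))
  Π⇒Bor (compl σ (B⊆ , ⊆B)) = Bor.resp (⊆B , B⊆) (complement (Σ⇒Bor σ))

  Σ-resp : ∀ {β A B} → A ≐ B → A ∈ Σ⁰ W β → B ∈ Σ⁰ W β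
  Σ-resp A≐B (one isOne o)                     = one isOne (Generated.resp A≐B o)
  Σ-resp (A⊆B , B⊆A) (step C π (A⊆ , ⊆A)) = step C π ((λ Bx → A⊆ (B⊆A Bx)) , λ Cx → A⊆B (⊆A Cx))

  Π⇒Σ : ∀ {β γ A} → Positive W β → β W.< γ → A ∈ Π⁰ W β → A ∈ Σ⁰ W γ
  Π⇒Σ pos β<γ π = step (λ _ → _) (λ _ → _ , pos , β<γ , π) ((λ Ax → nat 0 , Ax) , proj₂)

  Σ⇒Σ∁ : ∀ {β γ A} → Positive W β → β W.< γ → A ∈ Σ⁰ W β → ∁ A ∈ Σ⁰ W γ
  Σ⇒Σ∁ pos β<γ σ = Π⇒Σ pos β<γ (compl σ ((λ ¬Ax → ¬Ax) , λ ¬Ax → ¬Ax))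

  Σ⇒Π : ∀ {β γ A} → Positive W β → β W.< γ → A ∈ Σ⁰ W β → A ∈ Π⁰ W γ
  Σ⇒Π pos β<γ σ = compl (Σ⇒Σ∁ pos β<γ σ) ((λ Ax ¬Ax → ¬Ax Ax) , by-contra)

  module _ (α : Carrier W) (¬below : ¬ BelowSuccessor κ W α) (below : ∀ {β} → β W.< α → BelowSuccessor κ W β) where

    limit-α : ∀ {β} → β W.< α → ∃ λ γ → β W.< γ × γ W.< α
    limit-α {β} β<α = by-contra λ none → ¬below (F , λ {δ} {ε} → F-injective none δ ε)
      where
      f = proj₁ (below β<α)
      F : Carrier W → K
      F δ with em (δ W.< β)
      ... | yes _ = pair (nat 1) (f δ)
      ... | no _  = pair (nat 0) (nat 0)
      F-injective : ¬ (∃ λ γ → β W.< γ × γ W.< α) → ∀ δ ε → δ W.< α → ε W.< α → F δ ≡ F ε → δ ≡ ε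
      F-injective none δ ε δ<α ε<α eq with em (δ W.< β) | em (ε W.< β)
      ... | yes δ<β | yes ε<β = proj₂ (below β<α) δ<β ε<β (proj₂ (pair-injective eq))
      ... | yes _   | no _    = case nat-injective {1} {0} (proj₁ (pair-injective eq)) of λ ()
      ... | no _    | yes _   = case nat-injective {0} {1} (proj₁ (pair-injective eq)) of λ ()
      ... | no β≤δ  | no β≤ε  = ≡.trans (is-β δ<α β≤δ) (sym (is-β ε<α β≤ε))
        where
        is-β : ∀ {δ} → δ W.< α → β W.≤ δ → δ ≡ β
        is-β δ<α β≤δ with W.≤⇒<⊎≡ β≤δ
        ... | inj₁ β<δ = ⊥-elim (none (_ , β<δ , δ<α))
        ... | inj₂ β≡δ = sym β≡δ

    positive-α : Positive W α
    positive-α = by-contra λ none → ¬below ((λ _ → nat 0) , λ β<α → ⊥-elim (none (_ , β<α)))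

    one-α : ∃ λ β → IsOne W β × β W.< α
    one-α = let (β , β<α) = positive-α ; (γ , β<γ , γ<α) = limit-α β<α
                (δ , (pos , δ<α) , min) = W.least (λ δ → Positive W δ × δ W.< α) (γ , (β , β<γ) , γ<α)
            in δ , (pos , λ {ε} ε<δ pos′ → min ε ε<δ (pos′ , W.<-trans ε<δ δ<α)) , δ<α

    -- κ⁺ is regular, because κ · κ = κ.

    sup-α : (b : K → Carrier W) → (∀ γ → b γ W.< α) → ∃ λ β → β W.< α × (∀ γ → b γ W.< β)
    sup-α b b<α = by-contra λ none → ¬below (F , λ {δ} {ε} → F-injective none δ ε)
      where
      above : ∀ γ → ∃ λ δ → b γ W.< δ × δ W.< α
      above γ = limit-α (b<α γ)
      g : K → Carrier W → K
      g γ = proj₁ (below (proj₂ (proj₂ (above γ))))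
      g-injective : ∀ γ {δ ε} → δ W.≤ b γ → ε W.≤ b γ → g γ δ ≡ g γ ε → δ ≡ ε
      g-injective γ δ≤b ε≤b = proj₂ (below (proj₂ (proj₂ (above γ)))) (W.≤-<-trans δ≤b (proj₁ (proj₂ (above γ))))
                                                                        (W.≤-<-trans ε≤b (proj₁ (proj₂ (above γ))))
      index : Carrier W → K
      index δ = select (λ γ → δ W.≤ b γ) (nat 0)
      F : Carrier W → K
      F δ = pair (index δ) (g (index δ) δ)
      F-injective : ¬ (∃ λ β → β W.< α × (∀ γ → b γ W.< β)) → ∀ δ ε → δ W.< α → ε W.< α → F δ ≡ F ε → δ ≡ ε
      F-injective none δ ε δ<α ε<α eq =
        let (i≡ , g≡) = pair-injective eq in
        g-injective (index δ) (index-holds δ δ<α) (subst (λ γ → ε W.≤ b γ) (sym i≡) (index-holds ε ε<α))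
          (≡.trans g≡ (cong (λ γ → g γ ε) (sym i≡)))
        where
        index-holds : ∀ δ → δ W.< α → δ W.≤ b (index δ)
        index-holds δ δ<α = select-holds (λ γ → δ W.≤ b γ) (nat 0) (¬∀⇒∃¬ λ b<δ → none (δ , δ<α , b<δ))

    Low : Pred Space 0ℓ → Set₁
    Low A = ∃ λ β → β W.< α × Positive W β × A ∈ Σ⁰ W β

    open-low : ∀ {A} → A ∈ Open → Low A
    open-low o = let (β , isOne , β<α) = one-α in β , β<α , proj₁ isOne , one isOne o

    bor-low : ∀ {A} → A ∈ Bor → Low A
    bor-low (open′ o)        = open-low o
    bor-low (complement bA) = let (β , β<α , pos , σ) = bor-low bA ; (γ , β<γ , γ<α) = limit-α β<α in
      γ , γ<α , (β , β<γ) , Σ⇒Σ∁ pos β<γ σ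
    bor-low (Bor.resp A≐B bA) = let (β , β<α , pos , σ) = bor-low bA in β , β<α , pos , Σ-resp A≐B σ
    bor-low (Bor.union {J} e A bA) =
      let (β , β<α , b<β) = sup-α (λ γ → level γ) (λ γ → level<α γ) in
      β , β<α , (level (nat 0) , b<β (nat 0)) ,
      step (λ γ → proj₁ (entry γ)) (λ γ → level γ , level-positive γ , b<β γ , level-Π γ)
        ((λ (j , Ajx) → Injection.to e j , entry-⊇ j Ajx) , λ (γ , Cx) → entry-⊆ γ Cx)
      where
      Entry : K → Set₁
      Entry γ = ∃ λ C → Low C × (∀ x → C x → ⋃ J A x) × (∀ j → Injection.to e j ≡ γ → ∀ x → A j x → C x)
      entry : ∀ γ → Entry γ
      entry γ with em (∃ λ j → Injection.to e j ≡ γ)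
      ... | yes (j , ej≡γ) = A j , bor-low (bA j) , (λ x Ajx → j , Ajx) , λ i ei≡γ x Aix →
        subst (λ j → A j x) (Injection.injective e (≡.trans ei≡γ (sym ej≡γ))) Aix
      ... | no none = ∅ , open-low open-∅ , (λ _ ()) , λ j ej≡γ → ⊥-elim (none (j , ej≡γ))
      entry-⊇ : ∀ j {x} → A j x → proj₁ (entry (Injection.to e j)) x
      entry-⊇ j {x} = proj₂ (proj₂ (proj₂ (entry (Injection.to e j)))) j refl x
      entry-⊆ : ∀ γ {x} → proj₁ (entry γ) x → ⋃ J A x
      entry-⊆ γ {x} = proj₁ (proj₂ (proj₂ (entry γ))) x
      raise : ∀ {C} → Low C → ∃ λ β → β W.< α × Positive W β × C ∈ Π⁰ W β
      raise (β , β<α , pos , σ) = let (γ , β<γ , γ<α) = limit-α β<α in γ , γ<α , (β , β<γ) , Σ⇒Π pos β<γ σ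
      raised : ∀ γ → ∃ λ β → β W.< α × Positive W β × proj₁ (entry γ) ∈ Π⁰ W β
      raised γ = raise (proj₁ (proj₂ (entry γ)))
      level : K → Carrier W
      level γ = proj₁ (raised γ)
      level<α : ∀ γ → level γ W.< α
      level<α γ = proj₁ (proj₂ (raised γ))
      level-positive : ∀ γ → Positive W (level γ)
      level-positive γ = proj₁ (proj₂ (proj₂ (raised γ)))
      level-Π : ∀ γ → proj₁ (entry γ) ∈ Π⁰ W (level γ)
      level-Π γ = proj₂ (proj₂ (proj₂ (raised γ)))

    Bor⇒Σ : ∀ {A} → A ∈ Bor → A ∈ Σ⁰ W α
    Bor⇒Σ bA = let (β , β<α , pos , σ) = bor-low bA ; (γ , β<γ , γ<α) = limit-α β<α in
      Π⇒Σ (β , β<γ) γ<α (Σ⇒Π pos β<γ σ)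

theorem4p9 : Classical →
    (κ : WellOrder) → IsUncountableRegular κ →
    (𝓘 : Family (Carrier κ)) → IsCompleteProperIdeal κ 𝓘 → ContainsBounded κ 𝓘 →
    (ν : Base) →
    (∀ (W : WellOrder) (α : Carrier W) → Positive W α → BelowSuccessor κ W α →
    ¬ (Hierarchy.Σ⁰ κ 𝓘 ν W α ≐ Hierarchy.Bor κ 𝓘 ν))
    × (∀ (W : WellOrder) (α : Carrier W) → IsSuccessor κ W α →
    Hierarchy.HasLength κ 𝓘 ν W α)
theorem4p9 cl κ uncountableRegular 𝓘 ideal containsBounded ν =
  (λ W α _ → not-Bor W α) ,
  λ W α (¬below , below) → let open Length cl κ uncountableRegular 𝓘 ideal containsBounded ν W in
    positive-α α ¬below below , (Σ⇒Bor , Bor⇒Σ α ¬below below) , λ {β} _ β<α → not-Bor W β (below β<α)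
  where
  open Diagonal cl κ uncountableRegular 𝓘 ideal containsBounded ν using (Marks)
  open DisjointPositive cl κ uncountableRegular 𝓘 ideal containsBounded ν using (Splitting; splitting⇒marks)
  marks : Marks
  marks with Choice.em cl Splitting
  ... | yes splitting = splitting⇒marks splitting
  ... | no ¬splitting = AdjacentLimits.long-marks cl κ uncountableRegular 𝓘 ideal containsBounded ν ¬splitting
          (Saturated.minimal-function cl κ uncountableRegular 𝓘 ideal containsBounded ν ¬splitting)
  not-Bor : ∀ W α → BelowSuccessor κ W α → ¬ (Hierarchy.Σ⁰ κ 𝓘 ν W α ≐ Hierarchy.Bor κ 𝓘 ν)
  not-Bor W α (f , f-injective) =
    Borel.Evaluation.not-collapsed cl κ uncountableRegular 𝓘 ideal containsBounded ν W α f f-injective marks
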